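{- Let $G=(V,E)$ be a finite undirected graph with $n$ vertices and vertex weights $w(v)=\log_2|D(v)|$, where $D(v)$ is a finite set with at least two elements for each $v\in V$. Let $m$ and $\alpha\ge1$ be real numbers and let $W\subseteq V$ satisfy $w(W)<(\alpha+1)m$. Then the recursive algorithm $\mathrm{W\text{ - }Triangulate}(G,W,m)$ (defined in the context, with parameter $\alpha$) either triangulates $G$, by adding edges, in such a way that the vertices of $W$ form a clique and the weight of a heaviest clique of the triangulated graph is $<(2\alpha+1)m$, or it correctly outputs that the weighted cliquewidth of $G$ is larger than $m$.
   Context: For $S\subseteq V$, $w(S)=\sum_{v\in S}w(v)$. A triangulation of $G$ is a chordal graph on the same vertex set obtained from $G$ by adding edges. The weighted cliquewidth of $G$ is the minimum, over all triangulations $H$ of $G$, of the maximum weight of a clique of $H$ (equivalently, the weight of the heaviest clique in a junction tree of $G$ in which this weight is minimized). $G[S]$ denotes the subgraph induced by $S$. A decomposition of $G=(V,E)$ is a partition $(X,A,B,C)$ of $V$ with $A$ and $B$ non-empty ($X$ and $C$ may be empty) such that there are no edges of $G$ between any two of the sets $A,B,C$. If $w(V)\ge(2\alpha+1)m$, a weighted $W$-decomposition with respect to $(m,\alpha)$ is a decomposition $(X,A,B,C)$ of $G$ such that $w(W)<(\alpha+1)m$, $w(X)\le\alpha m$, $w((W\cap A)\cup X)<(\alpha+1)m$, $w((W\cap B)\cup X)<(\alpha+1)m$ and $w((W\cap C)\cup X)<(\alpha+1)m$. Algorithm $\mathrm{W\text{ - }Triangulate}(G,W,m)$ with $G=(V,E)$: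 If $w(V)<(2\alpha+1)m$, make $W$ a clique and triangulate the resulting graph by the minimum weight heuristic: repeatedly select a vertex $v$ of the current graph for which $\{v\}\cup N(v)$ has minimum weight ($N(v)$ being its neighbors in the current graph), make $N(v)$ a clique, and remove $v$ from the current graph. Otherwise, find a weighted $W$-decomposition $(X,A,B,C)$ of $G$ with respect to $(m,\alpha)$; if none is found (the search finds one whenever one exists), return "weighted cliquewidth $>m$". Otherwise call $\mathrm{W\text{ - }Triangulate}(G[A\cup X],(W\cap A)\cup X,m)$, $\mathrm{W\text{ - }Triangulate}(G[B\cup X],(W\cap B)\cup X,m)$ and $\mathrm{W\text{ - }Triangulate}(G[C\cup X],(W\cap C)\cup X,m)$, and then make $W\cup X$ a clique. The triangulated graph is $G$ together with all edges added in this call and in all recursive calls. If any recursive call returns "weighted cliquewidth $>m$", so does the whole algorithm. -}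

module Defs where

open import Algebra.Bundles using (CommutativeRing)
open import Algebra.Structures using (IsCommutativeRing)
import Algebra.Properties.Monoid.Mult as Mult
import Algebra.Properties.Monoid.Sum as Sum
import Algebra.Properties.Ring as RingProperties
open import Data.Bool as Bool using (if_then_else_)
open import Data.Fin using (Fin; toℕ)
open import Data.Fin.Properties using (all?) renaming (_≟_ to _≟ᶠ_)
open import Data.Fin.Subset
open import Data.Fin.Subset.Properties
open import Data.List using (List; []; _∷_; allFin; filter)
import Data.List.Extrema as Extrema
open import Data.List.Membership.Propositional.Properties
  using (∈-allFin; ∈-filter⁺; ∈-filter⁻)
import Data.List.Relation.Unary.All as All
open import Data.List.Relation.Unary.All using ([]; _∷_)
open import Data.List.Relation.Unary.AllPairs using (AllPairs; []; _∷_; allPairs?)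
open import Data.Nat as ℕ using (ℕ; zero; suc)
open import Data.Nat.DivMod using (_mod_)
open import Data.Nat.Induction using (<-wellFounded)
import Data.Nat.Properties as ℕ
open import Data.Product using (∃; ∃₂; ∃-syntax; _×_; _,_; proj₁; proj₂)
open import Data.Sum as Sum′ using (_⊎_; inj₁; inj₂)
open import Data.Vec using (tabulate)
import Data.Vec.Properties as Vec
open import Function using (_∘_; Injective)
open import Induction.WellFounded using (Acc; acc)
open import Level using (0ℓ)
open import Relation.Binary using (Rel; IsDecTotalOrder; DecTotalOrder; Decidable; Symmetric)
import Relation.Binary.Construct.NonStrictToStrict as ToStrict
open import Relation.Binary.PropositionalEquality using (_≡_; _≢_; refl; sym; trans; cong; subst)
open import Relation.Nullary using (¬_; Dec; yes; no; does)
open import Relation.Nullary.Decidable using (_×-dec_; _⊎-dec_; _→-dec_; ¬?; map′)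
open import Relation.Unary using (Pred; Satisfiable)

-- The real numbers, up to isomorphism.  The order is decidable and suprema
-- exist for arbitrary predicates: these are the classical reals.
record CompleteOrderedField : Set₁ where
  infix  4 _≈_ _≤_
  infixl 6 _+_
  infixl 7 _*_
  infix  8 -_
  field
    ℝ                 : Set
    _≈_ _≤_           : Rel ℝ 0ℓ
    _+_ _*_           : ℝ → ℝ → ℝ
    -_                : ℝ → ℝ
    0# 1#             : ℝ
    isCommutativeRing : IsCommutativeRing _≈_ _+_ _*_ -_ 0# 1#
    isDecTotalOrder   : IsDecTotalOrder _≈_ _≤_
    0≉1               : ¬ (0# ≈ 1#)
    inverse           : ∀ x → ¬ (x ≈ 0#) → ∃[ y ] (x * y ≈ 1#)
    +-monoʳ-≤         : ∀ x {y z} → y ≤ z → x + y ≤ x + z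
    *-nonneg          : ∀ {x y} → 0# ≤ x → 0# ≤ y → 0# ≤ x * y

  IsUpperBound : ∀ {ℓ} → Pred ℝ ℓ → Pred ℝ ℓ
  IsUpperBound P b = ∀ {x} → P x → x ≤ b

  IsSupremum : ∀ {ℓ} → Pred ℝ ℓ → Pred ℝ ℓ
  IsSupremum P s = IsUpperBound P s × (∀ {b} → IsUpperBound P b → s ≤ b)

  field
    complete : (P : Pred ℝ 0ℓ) → Satisfiable P → ∃ (IsUpperBound P) → ∃ (IsSupremum P)

  IsMaximum IsMinimum : ∀ {ℓ} → Pred ℝ ℓ → Pred ℝ ℓ
  IsMaximum P x = P x × (∀ {y} → P y → y ≤ x)
  IsMinimum P x = P x × (∀ {y} → P y → x ≤ y)

  commutativeRing : CommutativeRing 0ℓ 0ℓ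
  commutativeRing = record { isCommutativeRing = isCommutativeRing }

  decTotalOrder : DecTotalOrder 0ℓ 0ℓ 0ℓ
  decTotalOrder = record { isDecTotalOrder = isDecTotalOrder }

  open CommutativeRing commutativeRing public
    using (setoid; ring; +-monoid; +-cong; +-congˡ; +-congʳ; +-comm; +-assoc;
           +-identityˡ; +-identityʳ; -‿inverseˡ; -‿inverseʳ;
           *-cong; *-identityˡ; *-identityʳ; *-comm)
    renaming (refl to ≈-refl; sym to ≈-sym; trans to ≈-trans)
  open DecTotalOrder decTotalOrder public
    using (_≤?_; totalOrder; ≤-respˡ-≈; ≤-respʳ-≈)
    renaming (_≟_ to _≈?_; refl to ≤-refl; trans to ≤-trans; antisym to ≤-antisym;
              total to ≤-total;
              reflexive to ≤-reflexive)
  open ToStrict _≈_ _≤_ public using (_<_)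
  open Mult +-monoid public using (×-homo-1; ×-homo-+; ×-assocˡ; ×-congʳ)
    renaming (_×_ to _·_)
  open Sum +-monoid public using (sum)

  infix 4 _<?_
  _<?_ : Decidable _<_
  _<?_ = ToStrict.<-decidable _≈_ _≤_ _≈?_ _≤?_

  2# : ℝ
  2# = 1# + 1#

  fromℕ : ℕ → ℝ
  fromℕ k = k · 1#

  +-mono-≤ : ∀ {x y u v} → x ≤ y → u ≤ v → x + u ≤ y + v
  +-mono-≤ {x} {y} {u} {v} x≤y u≤v = ≤-trans (+-monoʳ-≤ x u≤v)
    (≤-respˡ-≈ (+-comm v x) (≤-respʳ-≈ (+-comm v y) (+-monoʳ-≤ v x≤y)))

  +-cancelˡ-≤ : ∀ x {y z} → x + y ≤ x + z → y ≤ z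
  +-cancelˡ-≤ x h = ≤-respˡ-≈ (cancel _) (≤-respʳ-≈ (cancel _) (+-monoʳ-≤ (- x) h))
    where
    cancel : ∀ y → - x + (x + y) ≈ y
    cancel y = ≈-trans (≈-sym (+-assoc _ _ _))
      (≈-trans (+-congʳ (-‿inverseˡ x)) (+-identityˡ y))

  0≤1 : 0# ≤ 1#
  0≤1 with ≤-total 0# 1#
  ... | inj₁ 0≤1 = 0≤1
  ... | inj₂ 1≤0 = ≤-respʳ-≈ -1*-1≈1 (*-nonneg 0≤-1 0≤-1)
    where
    open RingProperties ring using (-1*x≈-x; -‿involutive)
    0≤-1 : 0# ≤ - 1#
    0≤-1 = ≤-respˡ-≈ (-‿inverseˡ 1#) (≤-respʳ-≈ (+-identityʳ _) (+-monoʳ-≤ (- 1#) 1≤0))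
    -1*-1≈1 : - 1# * - 1# ≈ 1#
    -1*-1≈1 = ≈-trans (-1*x≈-x (- 1#)) (-‿involutive 1#)

  fromℕ-mono-≤ : ∀ {j k} → j ℕ.≤ k → fromℕ j ≤ fromℕ k
  fromℕ-mono-≤ {k = zero}  ℕ.z≤n       = ≤-refl
  fromℕ-mono-≤ {k = suc k} ℕ.z≤n       =
    ≤-respˡ-≈ (+-identityˡ 0#) (+-mono-≤ 0≤1 (fromℕ-mono-≤ {k = k} ℕ.z≤n))
  fromℕ-mono-≤             (ℕ.s≤s j≤k) = +-monoʳ-≤ 1# (fromℕ-mono-≤ j≤k)

  ·-monoʳ-≤ : ∀ k {x y} → x ≤ y → k · x ≤ k · y
  ·-monoʳ-≤ zero    x≤y = ≤-refl
  ·-monoʳ-≤ (suc k) x≤y = +-mono-≤ x≤y (·-monoʳ-≤ k x≤y)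

  ·-cancelˡ-≤ : ∀ k {x y} → suc k · x ≤ suc k · y → x ≤ y
  ·-cancelˡ-≤ k {x} {y} h with ≤-total x y
  ... | inj₁ x≤y = x≤y
  ... | inj₂ y≤x = +-cancelˡ-≤ (k · x)
    (≤-respˡ-≈ (+-comm _ _)
      (≤-trans h (≤-respʳ-≈ (+-comm _ _) (+-monoʳ-≤ y (·-monoʳ-≤ k y≤x)))))

  -- The rationals r = p / (1 + q) with p, q ∈ ℕ and 2 ^ r ≤ k, the latter
  -- raised to the power 1 + q.
  BelowLog₂ : ℕ → Pred ℝ 0ℓ
  BelowLog₂ k r = ∃₂ λ p q → suc q · r ≈ fromℕ p × 2 ℕ.^ p ℕ.≤ k ℕ.^ suc q

  0-belowLog₂ : ∀ k .{{_ : ℕ.NonZero k}} → BelowLog₂ k 0#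
  0-belowLog₂ k = 0 , 0 , ×-homo-1 0# , ℕ.m^n>0 k 1

  n<2^n : ∀ n → n ℕ.< 2 ℕ.^ n
  n<2^n zero    = ℕ.s≤s ℕ.z≤n
  n<2^n (suc n) = ℕ.≤-trans (ℕ.+-mono-≤ (ℕ.m^n>0 2 n) (n<2^n n))
    (ℕ.≤-reflexive (cong (2 ℕ.^ n ℕ.+_) (sym (ℕ.+-identityʳ _))))

  belowLog₂-bound : ∀ k → IsUpperBound (BelowLog₂ k) (fromℕ k)
  belowLog₂-bound k {r} (p , q , r≈p/q , 2^p≤k^q) = ·-cancelˡ-≤ q
    (≤-respˡ-≈ (≈-sym r≈p/q)
      (≤-respʳ-≈ (≈-sym (×-assocˡ 1# (suc q) k))
        (fromℕ-mono-≤ {p} {suc q ℕ.* k} (ℕ.≮⇒≥ λ q*k<p →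
          ℕ.<⇒≱ (ℕ.^-monoʳ-< 2 ℕ.≤-refl q*k<p) 2^p≤2^[q*k]))))
    where
    2^p≤2^[q*k] : 2 ℕ.^ p ℕ.≤ 2 ℕ.^ (suc q ℕ.* k)
    2^p≤2^[q*k] = ℕ.≤-trans 2^p≤k^q
      (ℕ.≤-trans (ℕ.^-monoˡ-≤ (suc q) (ℕ.<⇒≤ (n<2^n k)))
        (ℕ.≤-reflexive (trans
          (ℕ.^-*-assoc 2 k (suc q))
          (cong (2 ℕ.^_) (ℕ.*-comm k (suc q))))))

  -- log₂ k = sup { r ∈ ℚ≥0 | 2 ^ r ≤ k }
  log₂ : (k : ℕ) .{{_ : ℕ.NonZero k}} → ℝ
  log₂ k = proj₁ (complete (BelowLog₂ k) (0# , 0-belowLog₂ k) (fromℕ k , belowLog₂-bound k))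

-- Finite simple graphs whose vertices carry labels in Fin N.  The vertex set
-- need not contain every label, so that induced subgraphs keep their labels.
record Graph (N : ℕ) : Set₁ where
  infix 4 _~_ _~?_
  field
    V      : Subset N
    _~_    : Rel (Fin N) 0ℓ
    _~?_   : Decidable _~_
    ~-sym  : Symmetric _~_
    ~-irr  : ∀ {v} → ¬ (v ~ v)
    ~⇒∈    : ∀ {u v} → u ~ v → u ∈ V

  N[_] : Fin N → Subset N
  N[ v ] = tabulate λ u → does (v ~? u)

open Graph public using (V)

private
  variable
    N : ℕ

infixl 6 _∪ᴳ_
infixl 7 _[_]

_[_] : Graph N → Subset N → Graph N
G [ S ] = record
  { V     = V G ∩ S
  ; _~_   = λ u v → u ~ v × u ∈ S × v ∈ S
  ; _~?_  = λ u v → (u ~? v) ×-dec (u ∈? S) ×-dec (v ∈? S)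
  ; ~-sym = λ (u~v , u∈S , v∈S) → ~-sym u~v , v∈S , u∈S
  ; ~-irr = λ (v~v , _) → ~-irr v~v
  ; ~⇒∈   = λ (u~v , u∈S , _) → x∈p∩q⁺ (~⇒∈ u~v , u∈S)
  }
  where open Graph G hiding (V)

_∪ᴳ_ : Graph N → Graph N → Graph N
G ∪ᴳ H = record
  { V     = V G ∪ V H
  ; _~_   = λ u v → (u G.~ v) ⊎ (u H.~ v)
  ; _~?_  = λ u v → (u G.~? v) ⊎-dec (u H.~? v)
  ; ~-sym = Sum′.map G.~-sym H.~-sym
  ; ~-irr = λ { (inj₁ v~v) → G.~-irr v~v ; (inj₂ v~v) → H.~-irr v~v }
  ; ~⇒∈   = λ { (inj₁ u~v) → x∈p∪q⁺ (inj₁ (G.~⇒∈ u~v)) ; (inj₂ u~v) → x∈p∪q⁺ (inj₂ (H.~⇒∈ u~v)) }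
  }
  where
  module G = Graph G
  module H = Graph H

-- Labels in S that are not vertices of G are ignored.
makeClique : Graph N → Subset N → Graph N
makeClique G S = record
  { V     = V G
  ; _~_   = λ u v → u ~ v ⊎ (u ∈ V G ∩ S × v ∈ V G ∩ S × u ≢ v)
  ; _~?_  = λ u v → (u ~? v) ⊎-dec ((u ∈? V G ∩ S) ×-dec (v ∈? V G ∩ S) ×-dec ¬? (u ≟ᶠ v))
  ; ~-sym = λ { (inj₁ u~v) → inj₁ (~-sym u~v)
              ; (inj₂ (u∈S , v∈S , u≢v)) → inj₂ (v∈S , u∈S , u≢v ∘ sym) }
  ; ~-irr = λ { (inj₁ v~v) → ~-irr v~v ; (inj₂ (_ , _ , v≢v)) → v≢v refl }
  ; ~⇒∈   = λ { (inj₁ u~v) → ~⇒∈ u~v ; (inj₂ (u∈S , _)) → proj₁ (x∈p∩q⁻ _ _ u∈S) }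
  }
  where open Graph G hiding (V)

IsClique : Graph N → Subset N → Set
IsClique G S = S ⊆ V G × (∀ {u v} → u ∈ S → v ∈ S → u ≢ v → u ~ v)
  where open Graph G using (_~_)

next : ∀ {k} → Fin (suc k) → Fin (suc k)
next {k} i = suc (toℕ i) mod suc k

record Cycle (G : Graph N) (k : ℕ) : Set where
  open Graph G using (_~_)
  field
    vertex    : Fin (suc k) → Fin N
    injective : Injective _≡_ _≡_ vertex
    adjacent  : ∀ i → vertex i ~ vertex (next i)

HasChord : ∀ {G : Graph N} {k} → Cycle G k → Set
HasChord {G = G} c = ∃₂ λ i j → j ≢ next i × i ≢ next j × vertex i ~ vertex j
  where
  open Graph G using (_~_)
  open Cycle c using (vertex)

-- Cycle G k has k + 1 vertices.
Chordal : Graph N → Set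
Chordal G = ∀ {k} → 3 ℕ.≤ k → (c : Cycle G k) → HasChord c

record IsTriangulation (G H : Graph N) : Set where
  field
    sameVertices : V H ≡ V G
    addsEdges    : ∀ {u v} → Graph._~_ G u v → Graph._~_ H u v
    chordal      : Chordal H

Disjoint : Rel (Subset N) 0ℓ
Disjoint S T = Empty (S ∩ T)

Separated : Graph N → Rel (Subset N) 0ℓ
Separated G S T = ∀ {u v} → u ∈ S → v ∈ T → ¬ (u ~ v)
  where open Graph G using (_~_)

record IsDecomposition (G : Graph N) (X A B C : Subset N) : Set where
  field
    disjoint  : AllPairs Disjoint (X ∷ A ∷ B ∷ C ∷ [])
    covers    : ⋃ (X ∷ A ∷ B ∷ C ∷ []) ≡ V G
    A≢∅       : Nonempty A
    B≢∅       : Nonempty B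
    separated : AllPairs (Separated G) (A ∷ B ∷ C ∷ [])

isDecomposition? : ∀ (G : Graph N) X A B C → Dec (IsDecomposition G X A B C)
isDecomposition? G X A B C = map′
  (λ (p , q , r , s , t) → record
    { disjoint = p ; covers = q ; A≢∅ = r ; B≢∅ = s ; separated = t })
  (λ d → let open IsDecomposition d in disjoint , covers , A≢∅ , B≢∅ , separated)
  (allPairs? (λ S T → ¬? (nonempty? (S ∩ T))) _
    ×-dec Vec.≡-dec Bool._≟_ _ _
    ×-dec nonempty? A
    ×-dec nonempty? B
    ×-dec allPairs? separated? _)
  where
  open Graph G using (_~?_)
  separated? : Decidable (Separated G)
  separated? S T = map′ (λ f {u} {v} → f u v) (λ f u v → f {u} {v})
    (all? λ u → all? λ v → (u ∈? S) →-dec (v ∈? T) →-dec ¬? (u ~? v))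

module _ {G : Graph N} {X A B C : Subset N} (d : IsDecomposition G X A B C) where
  open IsDecomposition d

  private
    shrink : ∀ {S T} → Nonempty T → T ⊆ V G → Empty (S ∩ T) → Empty (X ∩ T) →
             ∣ V (G [ S ∪ X ]) ∣ ℕ.< ∣ V G ∣
    shrink {S} (t , t∈T) T⊆V S∩T X∩T = p⊂q⇒∣p∣<∣q∣
      (p∩q⊆p _ _ , t , T⊆V t∈T , λ t∈ → case (x∈p∪q⁻ S X (proj₂ (x∈p∩q⁻ (V G) _ t∈))))
      where
      case : t ∈ S ⊎ t ∈ X → _
      case (inj₁ t∈S) = S∩T (t , x∈p∩q⁺ (t∈S , t∈T))
      case (inj₂ t∈X) = X∩T (t , x∈p∩q⁺ (t∈X , t∈T))

    swap : ∀ {S T : Subset N} → Empty (S ∩ T) → Empty (T ∩ S)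
    swap {S} {T} e (x , x∈) = e (x , subst (x ∈_) (∩-comm T S) x∈)

    A⊆V : A ⊆ V G
    A⊆V a∈A = subst (_ ∈_) covers (x∈p∪q⁺ (inj₂ (x∈p∪q⁺ (inj₁ a∈A))))

    B⊆V : B ⊆ V G
    B⊆V b∈B = subst (_ ∈_) covers (x∈p∪q⁺ (inj₂ (x∈p∪q⁺ (inj₂ (x∈p∪q⁺ (inj₁ b∈B))))))

  ∣A∪X∣<∣V∣ : ∣ V (G [ A ∪ X ]) ∣ ℕ.< ∣ V G ∣
  ∣A∪X∣<∣V∣ with disjoint
  ... | (_ ∷ XB ∷ _) ∷ (AB ∷ _) ∷ _ = shrink B≢∅ B⊆V AB XB

  ∣B∪X∣<∣V∣ : ∣ V (G [ B ∪ X ]) ∣ ℕ.< ∣ V G ∣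
  ∣B∪X∣<∣V∣ with disjoint
  ... | (XA ∷ _) ∷ (AB ∷ _) ∷ _ = shrink A≢∅ A⊆V (swap {A} {B} AB) XA

  ∣C∪X∣<∣V∣ : ∣ V (G [ C ∪ X ]) ∣ ℕ.< ∣ V G ∣
  ∣C∪X∣<∣V∣ with disjoint
  ... | (XA ∷ _) ∷ (_ ∷ AC ∷ _) ∷ _ = shrink A≢∅ A⊆V (swap {A} {C} AC) XA

data Outcome (N : ℕ) : Set₁ where
  triangulated  : Graph N → Outcome N
  cliquewidth>m : Outcome N

module Weighted (R : CompleteOrderedField) {N : ℕ} (w : Fin N → CompleteOrderedField.ℝ R) where
  open CompleteOrderedField R

  weight : Subset N → ℝ
  weight S = sum λ v → if does (v ∈? S) then w v else 0#

  IsHeaviestCliqueWeight : Graph N → ℝ → Set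
  IsHeaviestCliqueWeight H = IsMaximum λ x → ∃[ S ] (IsClique H S × weight S ≈ x)

  IsWeightedCliquewidth : Graph N → ℝ → Set₁
  IsWeightedCliquewidth G = IsMinimum λ x → ∃[ H ] (IsTriangulation G H × IsHeaviestCliqueWeight H x)

  IsMinWeightVertex : Graph N → Fin N → Set
  IsMinWeightVertex G v =
    v ∈ V G × (∀ {u} → u ∈ V G → weight (⁅ v ⁆ ∪ N[ v ]) ≤ weight (⁅ u ⁆ ∪ N[ u ]))
    where open Graph G using (N[_])

  module _ (m α : ℝ) where

    record IsWDecomposition (G : Graph N) (W X A B C : Subset N) : Set where
      field
        isDecomposition : IsDecomposition G X A B C
        V-heavy         : (2# * α + 1#) * m ≤ weight (V G)
        W-light         : weight W < (α + 1#) * m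
        X-light         : weight X ≤ α * m
        A-light         : weight (W ∩ A ∪ X) < (α + 1#) * m
        B-light         : weight (W ∩ B ∪ X) < (α + 1#) * m
        C-light         : weight (W ∩ C ∪ X) < (α + 1#) * m

    HasWDecomposition : Graph N → Subset N → Set
    HasWDecomposition G W = ∃[ X ] ∃[ A ] ∃[ B ] ∃[ C ] IsWDecomposition G W X A B C

    -- The two steps the algorithm leaves open: which decomposition is found,
    -- and how ties between vertices are broken.
    record Choices : Set₁ where
      field
        findDecomposition : ∀ G W → Dec (HasWDecomposition G W)
        chooseVertex      : ∀ G → Nonempty (V G) → ∃ (IsMinWeightVertex G)

    isWDecomposition? : ∀ G W X A B C → Dec (IsWDecomposition G W X A B C)
    isWDecomposition? G W X A B C = map′
      (λ (p , q , r , s , t , u , v) → record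
        { isDecomposition = p ; V-heavy = q ; W-light = r ; X-light = s
        ; A-light = t ; B-light = u ; C-light = v })
      (λ d → let open IsWDecomposition d in
        isDecomposition , V-heavy , W-light , X-light , A-light , B-light , C-light)
      (isDecomposition? G X A B C ×-dec (_ ≤? _) ×-dec (_ <? _) ×-dec (_ ≤? _)
        ×-dec (_ <? _) ×-dec (_ <? _) ×-dec (_ <? _))

    -- Both steps can be carried out by exhaustive search.
    exhaustiveSearch : Choices
    exhaustiveSearch = record
      { findDecomposition = λ G W →
          anySubset? λ X → anySubset? λ A → anySubset? λ B → anySubset? λ C →
            isWDecomposition? G W X A B C
      ; chooseVertex = minVertex
      }
      where
      minVertex : ∀ G → Nonempty (V G) → ∃ (IsMinWeightVertex G)
      minVertex G (v₀ , v₀∈V) = argmin f v₀ vs ,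
        argmin-all f {xs = vs} v₀∈V (All.tabulate λ u∈vs → proj₂ (∈-filter⁻ (_∈? V G) {xs = allFin N} u∈vs)) ,
        λ u∈V → All.lookup (f[argmin]≤f[xs] v₀ vs) (∈-filter⁺ (_∈? V G) (∈-allFin _) u∈V)
        where
        open Extrema totalOrder using (argmin; argmin-all; f[argmin]≤f[xs])
        vs : List (Fin N)
        vs = filter (_∈? V G) (allFin N)
        f : Fin N → ℝ
        f u = weight (⁅ u ⁆ ∪ Graph.N[_] G u)

    module _ (choices : Choices) where
      open Choices choices

      private
        removeVertex : ∀ (G : Graph N) {v} → v ∈ V G → ∣ V (G [ ∁ ⁅ v ⁆ ]) ∣ ℕ.< ∣ V G ∣
        removeVertex G {v} v∈V = p⊂q⇒∣p∣<∣q∣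
          (p∩q⊆p _ _ , v , v∈V , λ v∈ → x∈∁p⇒x∉p (proj₂ (x∈p∩q⁻ (V G) _ v∈)) (x∈⁅x⁆ v))

      fillAcc : (G : Graph N) → Acc ℕ._<_ ∣ V G ∣ → Graph N
      fillAcc G (acc rs) with nonempty? (V G)
      ... | no  _   = G
      ... | yes V≢∅ =
        let v , v∈V , _ = chooseVertex G V≢∅
            G′          = makeClique G (Graph.N[_] G v)
        in G′ ∪ᴳ fillAcc (G′ [ ∁ ⁅ v ⁆ ]) (rs (removeVertex G′ v∈V))

      minWeightFill : Graph N → Graph N
      minWeightFill G = fillAcc G (<-wellFounded _)

      combine : Graph N → Subset N → Outcome N → Outcome N → Outcome N → Outcome N
      combine G S (triangulated H₁) (triangulated H₂) (triangulated H₃) =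
        triangulated (makeClique (G ∪ᴳ H₁ ∪ᴳ H₂ ∪ᴳ H₃) S)
      combine _ _ _ _ _ = cliquewidth>m

      wTriangulateAcc : (G : Graph N) → Subset N → Acc ℕ._<_ ∣ V G ∣ → Outcome N
      wTriangulateAcc G W (acc rs) with weight (V G) <? (2# * α + 1#) * m
      ... | yes _ = triangulated (minWeightFill (makeClique G W))
      ... | no  _ with findDecomposition G W
      ...   | no  _ = cliquewidth>m
      ...   | yes (X , A , B , C , d) = combine G (W ∪ X)
        (wTriangulateAcc (G [ A ∪ X ]) (W ∩ A ∪ X) (rs (∣A∪X∣<∣V∣ isDecomposition)))
        (wTriangulateAcc (G [ B ∪ X ]) (W ∩ B ∪ X) (rs (∣B∪X∣<∣V∣ isDecomposition)))
        (wTriangulateAcc (G [ C ∪ X ]) (W ∩ C ∪ X) (rs (∣C∪X∣<∣V∣ isDecomposition)))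
        where open IsWDecomposition d using (isDecomposition)

      wTriangulate : Graph N → Subset N → Outcome N
      wTriangulate G W = wTriangulateAcc G W (<-wellFounded _)

{-# OPTIONS --safe #-}

-- Chordal graphs are the graphs with a perfect elimination ordering (Dirac):
-- the first vertex of a cycle to be eliminated gives a chord, and conversely
-- a clique K that is not all of a chordal graph misses some simplicial vertex.
-- Orderings of the parts that eliminate (W ∩ part) ∪ X last can be
-- concatenated, so the union of the three triangulations is a triangulation
-- once W ∪ X is a clique, and its cliques lie in W ∪ X or in one part.
--
-- If H triangulates G and its cliques weigh at most m < w(V), then H has
-- a clique X such that V ∖ X splits into three mutually separated sets A, B, C
-- with A and B non-empty, each of which has at most half of the weight of W or
-- forms a clique together with X.  To find it, follow a perfect elimination
-- ordering and keep track of the connected pieces that have been eliminated,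
-- up to the first vertex v such that what lies beyond v, its later neighbours
-- and the pieces attached to v has at most half of the weight of W.  As
-- m ≤ α m, this is a weighted W-decomposition, so if none exists for an
-- induced subgraph of G, then the cliquewidth of G exceeds m.

module Submission where

import Algebra.Properties.CommutativeMonoid.Sum as CommutativeSum
open import Algebra.Bundles using (CommutativeRing)
open import Defs
open import Data.Bool using (true; if_then_else_)
open import Data.Empty using (⊥-elim)
open import Data.Fin using (Fin; zero; suc; toℕ)
open import Data.Fin.Patterns using (0F; 1F; 2F)
open import Data.Fin.Properties using (all?; any?; toℕ<n; toℕ-injective; toℕ-fromℕ<) renaming (_≟_ to _≟ᶠ_)
open import Data.Fin.Subset
open import Data.Fin.Subset.Properties
open import Data.List using (List; []; _∷_; length; lookup; filter; map; allFin)
open import Data.List.Membership.Propositional using (find; lose) renaming (_∈_ to _∈ˡ_)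
open import Data.List.Membership.Propositional.Properties using (∈-allFin; ∈-lookup; ∈-filter⁺; ∈-filter⁻)
open import Data.List.Relation.Unary.All as All using (All; []; _∷_)
import Data.List.Relation.Unary.All.Properties as All
open import Data.List.Relation.Unary.AllPairs as AllPairs using (AllPairs; []; _∷_)
import Data.List.Relation.Unary.AllPairs.Properties as AllPairs
open import Data.List.Relation.Unary.Any as Any using (Any; here; there)
import Data.List.Relation.Unary.Any.Properties as Any
open import Data.List.Relation.Unary.Unique.Propositional using (Unique)
open import Data.List.Relation.Unary.Unique.Propositional.Properties using (allFin⁺)
open import Data.Nat as ℕ using (ℕ; zero; suc; z≤n; s≤s; _%_)
open import Data.Nat.DivMod using (_mod_; m%n<n; m<n⇒m%n≡m; n%n≡0; [m+n]%n≡m%n; %-distribˡ-+; m≤n⇒[n∸m]%m≡n%m)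
open import Data.Nat.Induction using (<-wellFounded)
open import Data.Nat.Properties as ℕ using (<⇒≤)
open import Data.Product using (∃; ∃-syntax; _×_; _,_; proj₁; proj₂; uncurry)
open import Data.Sum as Sum using (_⊎_; inj₁; inj₂; [_,_]′)
open import Data.Unit using (tt) renaming (⊤ to Unit)
open import Data.Vec using (tabulate; []; _∷_)
open import Data.Vec.Base using (here; there)
open import Data.Vec.Properties using (lookup∘tabulate; lookup⇒[]=; []=⇒lookup)
open import Function using (_↔_; _∘_; id; Injective)
open import Induction.WellFounded using (Acc; acc)
open import Relation.Binary using (Symmetric)
open import Relation.Binary.Construct.Closure.ReflexiveTransitive as Star using (Star; ε; _◅_; _◅◅_)
open import Relation.Binary.PropositionalEquality using (_≡_; _≢_; refl; sym; trans; cong; subst; module ≡-Reasoning)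
open import Relation.Nullary using (¬_; Dec; yes; no; does; contradiction)
open import Relation.Nullary.Decidable using (dec-true; ¬?; _×-dec_; _→-dec_; map′; decidable-stable)

-- The obstacle is that both `A` and `B` must be non-empty: a balanced clique separator may leave
-- only a single part. Another clique of `H` then serves as separator and cuts off one vertex or one
-- piece; a part whose share of `W` is not controlled lies with it in a clique, hence weighs at most
-- m < (α+1)m. One half is the right fraction for two reasons. Half of w(W) plus w(X) is less than
-- (α+1)m/2 + m, which is at most (α+1)m exactly when m ≤ αm. And of two disjoint sets, one always
-- has at most half, so surplus parts can be merged until three remain. The bound 2α+1 is α for `X`
-- plus α+1 for `W`. The sign of m comes from 0 ≤ w(W) < (α+1)m. The negative answer speaks of a
-- minimum over all triangulations, which range over a large type and are not enumerated. The
-- induction therefore uses "no triangulation has all cliques of weight at most m", where failure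
-- for an induced subgraph implies failure for the whole graph; that the minimum is attained is
-- shown separately, by recursion on a simplicial vertex.

private
  variable
    N : ℕ

-- Perfect elimination orderings

x∈p─q⇒x∉q : ∀ {n} {x : Fin n} (p q : Subset n) → x ∈ p ─ q → x ∉ q
x∈p─q⇒x∉q (_ ∷ p) (inside  ∷ q) (there x∈) (there x∈q) = x∈p─q⇒x∉q p q x∈ x∈q
x∈p─q⇒x∉q (_ ∷ p) (outside ∷ q) (there x∈) (there x∈q) = x∈p─q⇒x∉q p q x∈ x∈q

x∈p-y⁻ : ∀ {n} {x : Fin n} (p : Subset n) y → x ∈ p - y → x ∈ p × x ≢ y
x∈p-y⁻ p y x∈ = p─q⊆p p ⁅ y ⁆ x∈ ,
  λ { refl → x∈p─q⇒x∉q p ⁅ y ⁆ x∈ (x∈⁅x⁆ y) }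

∉-∪ : ∀ {n} {x : Fin n} {p q : Subset n} → x ∉ p → x ∉ q → x ∉ p ∪ q
∉-∪ {p = p} {q} x∉p x∉q = [ x∉p , x∉q ]′ ∘ x∈p∪q⁻ p q

∪-⊆ : ∀ {n} {p q r : Subset n} → p ⊆ r → q ⊆ r → p ∪ q ⊆ r
∪-⊆ {p = p} {q} p⊆r q⊆r = [ p⊆r , q⊆r ]′ ∘ x∈p∪q⁻ p q

∪-mono : ∀ {n} {p q r s : Subset n} → p ⊆ r → q ⊆ s → p ∪ q ⊆ r ∪ s
∪-mono p⊆r q⊆s = ∪-⊆ (x∈p∪q⁺ ∘ inj₁ ∘ p⊆r) (x∈p∪q⁺ ∘ inj₂ ∘ q⊆s)

infix 4 _~⟨_⟩_
_~⟨_⟩_ : Fin N → Graph N → Fin N → Set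
u ~⟨ G ⟩ v = Graph._~_ G u v

comprehension : ∀ {n} {P : Fin n → Set} → (∀ x → Dec (P x)) → Subset n
comprehension P? = tabulate (does ∘ P?)

∈-comprehension⁺ : ∀ {n} {P : Fin n → Set} (P? : ∀ x → Dec (P x)) {x} → P x → x ∈ comprehension P?
∈-comprehension⁺ P? {x} px = lookup⇒[]= x _ (trans (lookup∘tabulate _ x) (dec-true (P? x) px))

∈-comprehension⁻ : ∀ {n} {P : Fin n → Set} (P? : ∀ x → Dec (P x)) {x} → x ∈ comprehension P? → P x
∈-comprehension⁻ P? {x} x∈ = witness (P? x) (trans (sym (lookup∘tabulate _ x)) ([]=⇒lookup x∈))
  where
  witness : ∀ {A : Set} (A? : Dec A) → does A? ≡ true → A
  witness (yes a) _ = a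

∈-N⁺ : ∀ (G : Graph N) {u v} → v ~⟨ G ⟩ u → u ∈ Graph.N[_] G v
∈-N⁺ G {v = v} = ∈-comprehension⁺ (Graph._~?_ G v)

∈-N⁻ : ∀ (G : Graph N) {u v} → u ∈ Graph.N[_] G v → v ~⟨ G ⟩ u
∈-N⁻ G {v = v} = ∈-comprehension⁻ (Graph._~?_ G v)

~⇒∈ʳ : ∀ (G : Graph N) {u v} → u ~⟨ G ⟩ v → v ∈ V G
~⇒∈ʳ G u~v = Graph.~⇒∈ G (Graph.~-sym G u~v)

~⇒≢ : ∀ (G : Graph N) {u v} → u ~⟨ G ⟩ v → u ≢ v
~⇒≢ G u~v refl = Graph.~-irr G u~v

IsClique-⊆ : ∀ {G : Graph N} {S T} → IsClique G T → S ⊆ T → IsClique G S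
IsClique-⊆ (T⊆V , adj) S⊆T = T⊆V ∘ S⊆T , λ u∈S v∈S → adj (S⊆T u∈S) (S⊆T v∈S)

Simplicial : Graph N → Subset N → Fin N → Set
Simplicial G S v = ∀ {a b} → a ∈ S → b ∈ S → v ~⟨ G ⟩ a → v ~⟨ G ⟩ b → a ≢ b → a ~⟨ G ⟩ b

-- Eliminating simplicial vertices outside K, one after the other, shrinks
-- S to a subset of K; a perfect elimination ordering of S is the case K = ⊥.
data Reduces (G : Graph N) (K : Subset N) : Subset N → Set where
  done : ∀ {S} → S ⊆ K → Reduces G K S
  step : ∀ {S v} → v ∈ S → v ∉ K → Simplicial G S v → Reduces G K (S - v) → Reduces G K S

-- Vertices outside `T` are skipped. For the others, being simplicial is a condition on `T` alone,
-- where the two graphs agree.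
reduces-⊆ : ∀ {G H : Graph N} {K S T} → Reduces G K S → T ⊆ S →
            (∀ {u v} → u ∈ T → v ∈ T → u ~⟨ G ⟩ v → u ~⟨ H ⟩ v) →
            (∀ {u v} → u ∈ T → v ∈ T → u ~⟨ H ⟩ v → u ~⟨ G ⟩ v) →
            Reduces H K T
reduces-⊆ (done S⊆K) T⊆S _ _ = done (S⊆K ∘ T⊆S)
reduces-⊆ {S = S} {T} (step {v = v} v∈S v∉K simplicial reduces) T⊆S G⇒H H⇒G with v ∈? T
... | yes v∈T = step v∈T v∉K
  (λ a∈T b∈T v~a v~b a≢b → G⇒H a∈T b∈T
    (simplicial (T⊆S a∈T) (T⊆S b∈T) (H⇒G v∈T a∈T v~a) (H⇒G v∈T b∈T v~b) a≢b))
  (reduces-⊆ reduces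
    (λ x∈ → let x∈T , x≢v = x∈p-y⁻ T v x∈ in x∈p∧x≢y⇒x∈p-y (T⊆S x∈T) x≢v)
    (λ u∈ v∈ → G⇒H (p─q⊆p T _ u∈) (p─q⊆p T _ v∈))
    (λ u∈ v∈ → H⇒G (p─q⊆p T _ u∈) (p─q⊆p T _ v∈)))
... | no v∉T = reduces-⊆ reduces
  (λ { x∈T → x∈p∧x≢y⇒x∈p-y (T⊆S x∈T) λ { refl → v∉T x∈T } }) G⇒H H⇒G

-- Elimination in H of the part T of U, when outside K this part has no
-- neighbours in U beyond T.
reduces-part : ∀ {H U : Graph N} {K S T R} → Reduces H K T → T ⊆ S →
               (∀ {a u} → a ∈ T → a ∉ K → u ∈ S → a ~⟨ U ⟩ u → u ∈ T) →
               (∀ {u v} → u ~⟨ H ⟩ v → u ~⟨ U ⟩ v) →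
               (∀ {u v} → u ∈ T → v ∈ T → u ~⟨ U ⟩ v → u ~⟨ H ⟩ v) →
               (∀ {u} → u ∈ S → (u ∈ T → u ∈ K) → u ∈ R) →
               Reduces U ⊥ R → Reduces U ⊥ S
-- Once `T` has shrunk into `K`, the premise on `R` places all of `S` in `R`, and the elimination of
-- `R` takes over.
reduces-part (done T⊆K) T⊆S _ _ _ S⊆R R-reduces =
  reduces-⊆ R-reduces (λ u∈S → S⊆R u∈S T⊆K) (λ _ _ → id) (λ _ _ → id)
reduces-part {S = S} {T} (step {v = v} v∈T v∉K simplicial reduces) T⊆S closed H⇒U U⇒H S⊆R R-reduces =
  step (T⊆S v∈T) ∉⊥
    (λ a∈S b∈S v~a v~b a≢b →
      let a∈T = closed v∈T v∉K a∈S v~a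
          b∈T = closed v∈T v∉K b∈S v~b
      in H⇒U (simplicial a∈T b∈T (U⇒H v∈T a∈T v~a) (U⇒H v∈T b∈T v~b) a≢b))
    (reduces-part reduces
      (λ x∈ → let x∈T , x≢v = x∈p-y⁻ T v x∈ in x∈p∧x≢y⇒x∈p-y (T⊆S x∈T) x≢v)
      (λ a∈ a∉K u∈ a~u →
        let u∈S , u≢v = x∈p-y⁻ S v u∈
        in x∈p∧x≢y⇒x∈p-y (closed (p─q⊆p T _ a∈) a∉K u∈S a~u) u≢v)
      H⇒U
      (λ u∈ v∈ → U⇒H (p─q⊆p T _ u∈) (p─q⊆p T _ v∈))
      (λ u∈ T⇒K → let u∈S , u≢v = x∈p-y⁻ S v u∈ in
        S⊆R u∈S λ u∈T → T⇒K (x∈p∧x≢y⇒x∈p-y u∈T u≢v))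
      R-reduces)

-- The `t`-fold iterate of `next` in closed form, so that positions on a cycle can be told apart by
-- arithmetic.
rotate : ∀ {k} → ℕ → Fin (suc k) → Fin (suc k)
rotate {k} t i = (t ℕ.+ toℕ i) mod suc k

next-rotate : ∀ {k} t (i : Fin (suc k)) → next (rotate t i) ≡ rotate (suc t) i
next-rotate {k} t i = toℕ-injective (begin
  toℕ (next (rotate t i))               ≡⟨ toℕ-fromℕ< _ ⟩
  suc (toℕ (rotate t i)) % n            ≡⟨ cong (λ x → suc x % n) (toℕ-fromℕ< _) ⟩
  (1 ℕ.+ (t ℕ.+ toℕ i) % n) % n           ≡⟨ suc-% (t ℕ.+ toℕ i) ⟩
  suc (t ℕ.+ toℕ i) % n                 ≡⟨ toℕ-fromℕ< _ ⟨
  toℕ (rotate (suc t) i)                ∎)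
  where
  open ≡-Reasoning
  n : ℕ
  n = suc k
  suc-% : ∀ x → suc (x % n) % n ≡ suc x % n
  suc-% x = begin
    suc (x % n) % n                     ≡⟨ %-distribˡ-+ 1 (x % n) n ⟩
    (1 % n ℕ.+ x % n % n) % n           ≡⟨ cong (λ y → (1 % n ℕ.+ y) % n) (m<n⇒m%n≡m (m%n<n x n)) ⟩
    (1 % n ℕ.+ x % n) % n               ≡⟨ %-distribˡ-+ 1 x n ⟨
    suc x % n                           ∎

rotate-full : ∀ {k} (i : Fin (suc k)) → rotate (suc k) i ≡ i
rotate-full {k} i = toℕ-injective (begin
  toℕ (rotate (suc k) i)       ≡⟨ toℕ-fromℕ< _ ⟩
  (suc k ℕ.+ toℕ i) % suc k    ≡⟨ cong (_% suc k) (ℕ.+-comm (suc k) (toℕ i)) ⟩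
  (toℕ i ℕ.+ suc k) % suc k    ≡⟨ [m+n]%n≡m%n (toℕ i) (suc k) ⟩
  toℕ i % suc k                ≡⟨ m<n⇒m%n≡m (toℕ<n i) ⟩
  toℕ i                        ∎)
  where open ≡-Reasoning

-- The sum `suc t + toℕ i` stays below twice `suc k`, so it wraps around at most once. Without
-- wrapping it exceeds `toℕ i`; with one wrap, equality would force `suc t` to be `suc k`.
rotate≢ : ∀ {k} t (i : Fin (suc k)) → suc t ℕ.< suc k → rotate (suc t) i ≢ i
rotate≢ {k} t i t<k eq with suc t ℕ.+ toℕ i ℕ.<? suc k
... | yes small = ℕ.m≢1+n+m (toℕ i) (begin
  toℕ i                      ≡⟨ cong toℕ eq ⟨
  toℕ (rotate (suc t) i)     ≡⟨ toℕ-fromℕ< _ ⟩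
  (suc t ℕ.+ toℕ i) % suc k  ≡⟨ m<n⇒m%n≡m small ⟩
  suc t ℕ.+ toℕ i            ∎)
  where open ≡-Reasoning
... | no large = ℕ.<⇒≢ t<k (ℕ.+-cancelʳ-≡ (toℕ i) (suc t) (suc k) (begin
  x                          ≡⟨ ℕ.m+[n∸m]≡n (ℕ.≮⇒≥ large) ⟨
  suc k ℕ.+ (x ℕ.∸ suc k)    ≡⟨ cong (suc k ℕ.+_) excess ⟩
  suc k ℕ.+ toℕ i            ∎))
  where
  open ≡-Reasoning
  x : ℕ
  x = suc t ℕ.+ toℕ i
  x-bound : x ℕ.∸ suc k ℕ.< suc k
  x-bound = ℕ.m<n+o⇒m∸n<o x (suc k) (ℕ.+-mono-< t<k (toℕ<n i))
  excess : x ℕ.∸ suc k ≡ toℕ i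
  excess = begin
    x ℕ.∸ suc k            ≡⟨ m<n⇒m%n≡m x-bound ⟨
    (x ℕ.∸ suc k) % suc k  ≡⟨ m≤n⇒[n∸m]%m≡n%m (ℕ.≮⇒≥ large) ⟩
    x % suc k              ≡⟨ toℕ-fromℕ< _ ⟨
    toℕ (rotate (suc t) i) ≡⟨ cong toℕ eq ⟩
    toℕ i                  ∎

-- The first vertex of the cycle to be eliminated is the middle of a chord.
reduces⇒hasChord : ∀ {G : Graph N} {S k} → Reduces G ⊥ S → 3 ℕ.≤ k → (c : Cycle G k) →
                   (∀ i → Cycle.vertex c i ∈ S) → HasChord c
reduces⇒hasChord (done S⊆⊥) _ c c⊆S = ⊥-elim (∉⊥ (S⊆⊥ (c⊆S zero)))
reduces⇒hasChord {G = G} {S} {k} (step {v = v} _ _ simplicial reduces) 3≤k c c⊆S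
  with any? (λ i → Cycle.vertex c i ≟ᶠ v)
... | no  v∉c      = reduces⇒hasChord reduces 3≤k c
  λ i → x∈p∧x≢y⇒x∈p-y (c⊆S i) (λ eq → v∉c (i , eq))
... | yes (i , refl) = p , n , n≢ , p≢ ,
  simplicial (c⊆S p) (c⊆S n) (Graph.~-sym G p~i) (adjacent i) (p≢n ∘ injective)
  where
  open Cycle c
  p n : Fin (suc k)
  -- The predecessor of `i`: one more step completes the full turn of `k + 1` steps.
  p = rotate k i
  n = next i
  next-p : next p ≡ i
  next-p = trans (next-rotate k i) (rotate-full i)
  p~i : vertex p ~⟨ G ⟩ vertex i
  p~i = subst (λ j → vertex p ~⟨ G ⟩ vertex j) next-p (adjacent p)
  n≡ : n ≡ rotate 2 p
  n≡ = trans (cong next (sym next-p)) (next-rotate 1 p)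
  -- Together with `p ≢ n`, the chord conditions say that rotations by 1, 2 and 3 have no fixed
  -- point; the rotation by 3 uses `3 ≤ k` in full.
  n≢ : n ≢ next p
  n≢ eq = rotate≢ 0 i (s≤s (ℕ.≤-trans (s≤s z≤n) 3≤k)) (trans eq next-p)
  p≢n : p ≢ n
  p≢n eq = rotate≢ 1 p (s≤s (ℕ.≤-trans (s≤s (s≤s z≤n)) 3≤k)) (trans (sym n≡) (sym eq))
  p≢ : p ≢ next n
  p≢ eq = rotate≢ 2 p (s≤s 3≤k)
    (trans (sym (next-rotate 2 p)) (trans (cong next (sym n≡)) (sym eq)))

reduces⇒chordal : ∀ {G : Graph N} → Reduces G ⊥ (V G) → Chordal G
reduces⇒chordal {G = G} reduces 3≤k c =
  reduces⇒hasChord reduces 3≤k c λ i → Graph.~⇒∈ G (Cycle.adjacent c i)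

-- Induced paths

-- InducedPath G C t u vs: the vertices u ∷ vs form an induced path that ends
-- in t and has all vertices strictly between u and t in C.
data InducedPath (G : Graph N) (C : Subset N) (t : Fin N) : Fin N → List (Fin N) → Set where
  edge : ∀ {u} → u ~⟨ G ⟩ t → InducedPath G C t u (t ∷ [])
  cons : ∀ {u v vs} → v ∈ C → u ~⟨ G ⟩ v → All (λ x → ¬ (u ~⟨ G ⟩ x) × u ≢ x) vs →
         InducedPath G C t v vs → InducedPath G C t u (v ∷ vs)

module _ {G : Graph N} {C : Subset N} {t : Fin N} where
  open Graph G using (_~_; _~?_; ~-sym)

  suffix : ∀ {u v vs} → InducedPath G C t v vs → u ∈ˡ vs → u ≢ t → ∃ (InducedPath G C t u)
  suffix (edge _)          (here refl) u≢t = ⊥-elim (u≢t refl)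
  suffix (cons _ _ _ path) (here refl) _   = _ , path
  suffix (cons _ _ _ path) (there u∈)  u≢t = suffix path u∈ u≢t

  -- The new path leaves u through the last neighbour of u on the old one.
  attach : ∀ {u v vs} → InducedPath G C t v vs → All (u ≢_) vs → v ∈ C →
           u ~ v ⊎ Any (u ~_) vs → ∃ (InducedPath G C t u)
  attach (edge _) _ _ (inj₂ (here u~t)) = _ , edge u~t
  attach {u} path@(edge v~t) (u≢t ∷ []) v∈C (inj₁ u~v) with u ~? t
  ... | yes u~t = _ , edge u~t
  ... | no  u≁t = _ , cons v∈C u~v ((u≁t , u≢t) ∷ []) path
  attach (cons w∈C _ _ path) (_ ∷ u∉) _ (inj₂ (here u~w)) = attach path u∉ w∈C (inj₁ u~w)
  attach (cons w∈C _ _ path) (_ ∷ u∉) _ (inj₂ (there u~)) = attach path u∉ w∈C (inj₂ u~)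
  attach {u} path₀@(cons {v = w} {vs} w∈C _ _ path) (u≢w ∷ u∉) v∈C (inj₁ u~v)
    with Any.any? (u ~?_) (w ∷ vs)
  ... | yes (here u~w) = attach path u∉ w∈C (inj₁ u~w)
  ... | yes (there u~) = attach path u∉ w∈C (inj₂ u~)
  ... | no  u≁         = _ , cons v∈C u~v
    (All.tabulate λ x∈ → (λ u~x → u≁ (Any.map (λ { refl → u~x }) x∈)) , All.lookup (u≢w ∷ u∉) x∈)
    path₀

  -- If `u` already lies on the path, the path is cut there; otherwise `u` is new and can be
  -- attached.
  extend : ∀ {u v vs} → InducedPath G C t v vs → v ∈ C → u ~ v → u ≢ t → ∃ (InducedPath G C t u)
  extend {u} {v} {vs} path v∈C u~v u≢t with Any.any? (u ≟ᶠ_) vs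
  ... | yes u∈vs = suffix path u∈vs u≢t
  ... | no  u∉vs = attach path
    (All.tabulate λ x∈ u≡x → u∉vs (Any.map (trans u≡x) x∈)) v∈C (inj₁ u~v)

  induced-step : ∀ {u vs} → InducedPath G C t u vs → ∀ (i j : Fin (suc (length vs))) →
                 toℕ j ≡ suc (toℕ i) → lookup (u ∷ vs) i ~ lookup (u ∷ vs) j
  induced-step (edge u~t)          zero    (suc zero) _  = u~t
  induced-step (cons _ u~v _ _)    zero    (suc zero) _  = u~v
  induced-step (edge _)            (suc zero) (suc zero) ()
  induced-step (cons _ _ _ path)   (suc i) (suc j)    eq = induced-step path i j (ℕ.suc-injective eq)

  induced-adj : ∀ {u vs} → InducedPath G C t u vs → ∀ (i j : Fin (suc (length vs))) →
                lookup (u ∷ vs) i ~ lookup (u ∷ vs) j →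
                toℕ j ≡ suc (toℕ i) ⊎ toℕ i ≡ suc (toℕ j)
  induced-adj _ zero zero u~u = ⊥-elim (Graph.~-irr G u~u)
  induced-adj (edge _)       zero (suc zero) _ = inj₁ refl
  induced-adj (cons _ _ _ _) zero (suc zero) _ = inj₁ refl
  induced-adj (edge _)       (suc zero) zero _ = inj₂ refl
  induced-adj (cons _ _ _ _) (suc zero) zero _ = inj₂ refl
  induced-adj (cons _ _ u≁ _) zero (suc (suc j)) u~ =
    ⊥-elim (proj₁ (All.lookup u≁ (∈-lookup j)) u~)
  induced-adj (cons _ _ u≁ _) (suc (suc i)) zero ~u =
    ⊥-elim (proj₁ (All.lookup u≁ (∈-lookup i)) (~-sym ~u))
  induced-adj (edge _) (suc zero) (suc zero) t~t = ⊥-elim (Graph.~-irr G t~t)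
  induced-adj (cons _ _ _ path) (suc i) (suc j) i~j =
    Sum.map (cong suc) (cong suc) (induced-adj path i j i~j)

  induced-injective : ∀ {u vs} → InducedPath G C t u vs → Injective _≡_ _≡_ (lookup (u ∷ vs))
  induced-injective _ {zero} {zero} _ = refl
  induced-injective (edge u~t) {zero} {suc zero} eq = ⊥-elim (~⇒≢ G u~t eq)
  induced-injective (edge u~t) {suc zero} {zero} eq = ⊥-elim (~⇒≢ G u~t (sym eq))
  induced-injective (edge _) {suc zero} {suc zero} _ = refl
  induced-injective (cons _ u~v _ _) {zero} {suc zero} eq = ⊥-elim (~⇒≢ G u~v eq)
  induced-injective (cons _ u~v _ _) {suc zero} {zero} eq = ⊥-elim (~⇒≢ G u~v (sym eq))
  induced-injective (cons _ _ u≁ _) {zero} {suc (suc j)} eq =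
    ⊥-elim (proj₂ (All.lookup u≁ (∈-lookup j)) eq)
  induced-injective (cons _ _ u≁ _) {suc (suc i)} {zero} eq =
    ⊥-elim (proj₂ (All.lookup u≁ (∈-lookup i)) (sym eq))
  induced-injective (cons _ _ _ path) {suc i} {suc j} eq = cong suc (induced-injective path eq)

  induced-interior : ∀ {u vs} → InducedPath G C t u vs → ∀ (i : Fin (length vs)) →
                     lookup vs i ∈ C ⊎ suc (toℕ i) ≡ length vs
  induced-interior (edge _) zero = inj₂ refl
  induced-interior (cons v∈C _ _ _) zero = inj₁ v∈C
  induced-interior (cons _ _ _ path) (suc i) = Sum.map₂ (cong suc) (induced-interior path i)

  induced-last : ∀ {u vs} → InducedPath G C t u vs → ∀ (i : Fin (length vs)) →
                 suc (toℕ i) ≡ length vs → lookup vs i ≡ t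
  induced-last (edge _) zero _ = refl
  induced-last (cons _ _ _ (edge _)) zero ()
  induced-last (cons _ _ _ (cons _ _ _ _)) zero ()
  induced-last (cons _ _ _ path) (suc i) eq = induced-last path i (ℕ.suc-injective eq)

toℕ-next : ∀ {k} (i : Fin (suc k)) → suc (toℕ i) ℕ.< suc k → toℕ (next i) ≡ suc (toℕ i)
toℕ-next i i<k = trans (toℕ-fromℕ< _) (m<n⇒m%n≡m i<k)

next-last : ∀ {k} (i : Fin (suc k)) → toℕ i ≡ k → next i ≡ zero
next-last {k} i i≡k = toℕ-injective (trans (toℕ-fromℕ< _)
  (trans (cong (λ x → suc x % suc k) i≡k) (n%n≡0 (suc k))))

-- x and an induced path between two of its neighbours, with interior in C,
-- would form a chordless cycle.
chordal⇒adjacent : ∀ {G : Graph N} {C : Subset N} {x s t vs} → Chordal G →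
                   x ~⟨ G ⟩ s → x ~⟨ G ⟩ t →
                   (∀ {c} → c ∈ C → ¬ (x ~⟨ G ⟩ c) × x ≢ c) →
                   InducedPath G C t s vs → s ~⟨ G ⟩ t
chordal⇒adjacent _ _ _ _ (edge s~t) = s~t
chordal⇒adjacent {N = N} {G} {C} {x} {s} {t} {vs} chordal x~s x~t x≁C path@(cons _ _ _ tail) =
  -- The path is not a single edge, so `vs` has at least two entries and the cycle at least four
  -- vertices.
  ⊥-elim (let i , j , j≢ , i≢ , i~j = chordal (s≤s (s≤s (nonempty tail))) cycle
          in chordless i j j≢ i≢ i~j)
  where
  open Graph G using (~-sym)
  nonempty : ∀ {v ws} → InducedPath G C t v ws → 1 ℕ.≤ length ws
  nonempty (edge _)       = s≤s z≤n
  nonempty (cons _ _ _ _) = s≤s z≤n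
  L : List (Fin N)
  L = x ∷ s ∷ vs
  n : ℕ
  n = suc (length vs)
  x≢ : ∀ (i : Fin (length vs)) → x ≢ lookup vs i
  x≢ i eq with induced-interior path i
  ... | inj₁ i∈C = proj₂ (x≁C i∈C) eq
  ... | inj₂ i≡  = ~⇒≢ G x~t (trans eq (induced-last path i i≡))
  injective : Injective _≡_ _≡_ (lookup L)
  injective {zero} {zero} _ = refl
  injective {zero} {suc zero} eq = ⊥-elim (~⇒≢ G x~s eq)
  injective {suc zero} {zero} eq = ⊥-elim (~⇒≢ G x~s (sym eq))
  injective {zero} {suc (suc j)} eq = ⊥-elim (x≢ j eq)
  injective {suc (suc i)} {zero} eq = ⊥-elim (x≢ i (sym eq))
  injective {suc i} {suc j} eq = cong suc (induced-injective path eq)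
  adjacent : ∀ (i : Fin (suc n)) → lookup L i ~⟨ G ⟩ lookup L (next i)
  adjacent zero = subst (λ j → x ~⟨ G ⟩ lookup L j)
    (toℕ-injective {i = suc zero} (sym (toℕ-next {n} zero (s≤s (s≤s z≤n))))) x~s
  adjacent (suc i) with next (suc i) in eq
  adjacent (suc i) | suc j with suc (suc (toℕ i)) ℕ.<? suc n
  ... | yes i<n = induced-step path i j
    (ℕ.suc-injective (trans (cong toℕ (sym eq)) (toℕ-next (suc i) i<n)))
  ... | no  i≮n = ⊥-elim (contradiction (trans (sym eq) (next-last (suc i)
    (ℕ.≤-antisym (toℕ<n i) (ℕ.≤-pred (ℕ.≮⇒≥ i≮n))))) λ ())
  adjacent (suc zero) | zero = ⊥-elim (contradiction
    (trans (sym (toℕ-next {n} (suc zero) (s≤s (s≤s (ℕ.≤-trans (s≤s z≤n) (nonempty path)))))) (cong toℕ eq)) λ ())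
  adjacent (suc (suc i)) | zero with suc (suc (suc (toℕ i))) ℕ.<? suc n
  ... | yes i<n = ⊥-elim (contradiction (trans (sym (toℕ-next (suc (suc i)) i<n)) (cong toℕ eq)) λ ())
  ... | no  i≮n = subst (_~⟨ G ⟩ x)
    (sym (induced-last path i (ℕ.≤-antisym (toℕ<n i) (ℕ.≤-pred (ℕ.≤-pred (ℕ.≮⇒≥ i≮n))))))
    (~-sym x~t)
  cycle : Cycle G n
  cycle = record { vertex = lookup L ; injective = injective ; adjacent = adjacent }
  -- On the path, `x` is adjacent only to the two ends, and these are its neighbours on the cycle.
  not-x : ∀ (j : Fin n) → suc j ≢ next {n} zero → zero ≢ next {n} (suc j) → ¬ (x ~⟨ G ⟩ lookup (s ∷ vs) j)
  not-x zero j≢ _ _ = j≢ (toℕ-injective (sym (toℕ-next {n} zero (s≤s (s≤s z≤n)))))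
  not-x (suc j) _ x≢next x~j with induced-interior path j
  ... | inj₁ j∈C = proj₁ (x≁C j∈C) x~j
  ... | inj₂ j≡  = x≢next (sym (next-last (suc (suc j)) (cong suc j≡)))
  suc≡next : ∀ (i j : Fin n) → toℕ j ≡ suc (toℕ i) → suc j ≡ next {n} (suc i)
  suc≡next i j j≡ = toℕ-injective (trans (cong suc j≡)
    (sym (toℕ-next {n} (suc i) (s≤s (subst (ℕ._< n) j≡ (toℕ<n j))))))
  chordless : ∀ i j → j ≢ next {n} i → i ≢ next {n} j → ¬ (lookup L i ~⟨ G ⟩ lookup L j)
  chordless zero    zero    _  _  x~x = Graph.~-irr G x~x
  chordless zero    (suc j) j≢ i≢ x~j = not-x j j≢ i≢ x~j
  chordless (suc i) zero    j≢ i≢ i~x = not-x i i≢ j≢ (~-sym i~x)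
  chordless (suc i) (suc j) j≢ i≢ i~j with induced-adj path i j i~j
  ... | inj₁ j≡ = j≢ (suc≡next i j j≡)
  ... | inj₂ i≡ = i≢ (suc≡next j i i≡)

-- Dirac's theorem

∣─∪⁅⁆∣< : ∀ {n} {x : Fin n} (A C : Subset n) → x ∈ A → x ∉ C → ∣ A ─ (C ∪ ⁅ x ⁆) ∣ ℕ.< ∣ A ─ C ∣
∣─∪⁅⁆∣< {x = x} A C x∈A x∉C = p⊂q⇒∣p∣<∣q∣
  ( (λ y∈ → x∈p∧x∉q⇒x∈p─q (p─q⊆p A _ y∈) λ y∈C → x∈p─q⇒x∉q A _ y∈ (p⊆p∪q _ y∈C))
  , x , x∈p∧x∉q⇒x∈p─q x∈A x∉C
  , λ x∈ → x∈p─q⇒x∉q A _ x∈ (q⊆p∪q C _ (x∈⁅x⁆ x)))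

module _ (G : Graph N) where
  open Graph G using (_~_; _~?_; ~-sym)

  Connected : Subset N → Set
  Connected C = ∀ {a b} → a ∈ C → b ∈ C → Star (λ u v → u ~ v × u ∈ C × v ∈ C) a b

  connected-∪⁅⁆ : ∀ {C c z} → Connected C → c ∈ C → c ~ z → Connected (C ∪ ⁅ z ⁆)
  connected-∪⁅⁆ {C} {c} {z} connected c∈C c~z a∈ b∈ =
    to-c (x∈p∪q⁻ C _ a∈) ◅◅ from-c (x∈p∪q⁻ C _ b∈)
    where
    Edge : Fin N → Fin N → Set
    Edge u v = u ~ v × u ∈ C ∪ ⁅ z ⁆ × v ∈ C ∪ ⁅ z ⁆
    old : ∀ {a b} → Star (λ u v → u ~ v × u ∈ C × v ∈ C) a b → Star Edge a b
    old = Star.map λ (u~v , u∈ , v∈) → u~v , p⊆p∪q _ u∈ , p⊆p∪q _ v∈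
    to-c : ∀ {a} → a ∈ C ⊎ a ∈ ⁅ z ⁆ → Star Edge a c
    to-c (inj₁ a∈C) = old (connected a∈C c∈C)
    to-c (inj₂ a∈z) with refl ← x∈⁅y⁆⇒x≡y z a∈z =
      (~-sym c~z , q⊆p∪q C _ a∈z , p⊆p∪q _ c∈C) ◅ ε
    from-c : ∀ {b} → b ∈ C ⊎ b ∈ ⁅ z ⁆ → Star Edge c b
    from-c (inj₁ b∈C) = old (connected c∈C b∈C)
    from-c (inj₂ b∈z) with refl ← x∈⁅y⁆⇒x≡y z b∈z =
      (c~z , p⊆p∪q _ c∈C , q⊆p∪q C _ b∈z) ◅ ε

  record Component (A : Subset N) (y : Fin N) : Set where
    field
      body      : Subset N
      root      : y ∈ body
      within    : body ⊆ A
      connected : Connected body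
      closed    : ∀ {c z} → c ∈ body → z ∈ A → c ~ z → z ∈ body

  component : ∀ {A y} → y ∈ A → Component A y
  component {A} {y} y∈A = grow ⁅ y ⁆ (<-wellFounded _) (x∈⁅x⁆ y)
    (λ x∈ → subst (_∈ A) (sym (x∈⁅y⁆⇒x≡y y x∈)) y∈A)
    (λ {a} {b} a∈ b∈ → subst (Star _ a) (trans (x∈⁅y⁆⇒x≡y y a∈) (sym (x∈⁅y⁆⇒x≡y y b∈))) ε)
    where
    grow : ∀ C → Acc ℕ._<_ ∣ A ─ C ∣ → y ∈ C → C ⊆ A → Connected C → Component A y
    grow C (acc rs) y∈C C⊆A connected
      with any? (λ c → any? λ z → (c ∈? C) ×-dec (z ∈? A) ×-dec ¬? (z ∈? C) ×-dec (c ~? z))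
    ... | no closed = record
      { body = C ; root = y∈C ; within = C⊆A ; connected = connected
      ; closed = λ {c} {z} c∈C z∈A c~z →
          decidable-stable (z ∈? C) λ z∉C → closed (c , z , c∈C , z∈A , z∉C , c~z) }
    ... | yes (c , z , c∈C , z∈A , z∉C , c~z) = grow (C ∪ ⁅ z ⁆) (rs (∣─∪⁅⁆∣< A C z∈A z∉C))
      (p⊆p∪q _ y∈C)
      (∪-⊆ C⊆A λ x∈ → subst (_∈ A) (sym (x∈⁅y⁆⇒x≡y z x∈)) z∈A)
      (connected-∪⁅⁆ connected c∈C c~z)

  -- The path is built backwards from the end of the walk; `extend` shortens it whenever a new
  -- vertex is on it or has a neighbour further along.
  walk⇒inducedPath : ∀ {C a b t} → t ∉ C → a ∈ C → Star (λ u v → u ~ v × u ∈ C × v ∈ C) a b →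
                     b ~ t → ∃ (InducedPath G C t a)
  walk⇒inducedPath _ _ ε b~t = _ , edge b~t
  walk⇒inducedPath {C} {a} t∉C a∈C ((a~v , _ , v∈C) ◅ walk) b~t =
    extend (proj₂ (walk⇒inducedPath t∉C v∈C walk b~t)) v∈C a~v λ { refl → t∉C a∈C }

  PairwiseAdjacent : Subset N → Set
  PairwiseAdjacent K = ∀ {u v} → u ∈ K → v ∈ K → u ≢ v → u ~ v

  module _ (chordal : Chordal G) where

    SimplicialOutside : Subset N → Subset N → Set
    SimplicialOutside S K = ∃[ v ] (v ∈ S × v ∉ K × Simplicial G S v)

    -- The neighbours of a component C of S - N[x] form a clique, and the
    -- simplicial vertices of C ∪ N(C) that lie in C are simplicial in S.
    module _ {S x z} (x∈S : x ∈ S) (z∈S : z ∈ S) (z≢x : z ≢ x) (x≁z : ¬ (x ~ z))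
             (ih : ∀ T L {y} → ∣ T ∣ ℕ.< ∣ S ∣ → L ⊆ T → PairwiseAdjacent L →
                   y ∈ T → y ∉ L → SimplicialOutside T L) where

      nonneighbour? : ∀ u → Dec (u ∈ S × u ≢ x × ¬ (x ~ u))
      nonneighbour? u = (u ∈? S) ×-dec ¬? (u ≟ᶠ x) ×-dec ¬? (x ~? u)

      simplicial-nonneighbour : ∃[ v ] (v ∈ S × v ≢ x × ¬ (x ~ v) × Simplicial G S v)
      simplicial-nonneighbour
        with component (∈-comprehension⁺ nonneighbour? (z∈S , z≢x , x≁z))
      ... | record { body = C ; root = z∈C ; within = C⊆ ; connected = connected ; closed = closed } =
        let v , v∈T , v∉L , simplicial = ih (C ∪ L) L T<S (q⊆p∪q C L) L-clique (p⊆p∪q L z∈C) (λ z∈L → proj₁ (proj₂ (∈L z∈L)) z∈C)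
            v∈C = [ id , (λ v∈L → ⊥-elim (v∉L v∈L)) ]′ (x∈p∪q⁻ C L v∈T)
            v∈S , v≢x , x≁v = ∈C v∈C
        in v , v∈S , v≢x , x≁v , λ a∈S b∈S v~a v~b →
          simplicial (N⊆T v∈C a∈S v~a) (N⊆T v∈C b∈S v~b) v~a v~b
        where
        ∈C : ∀ {u} → u ∈ C → u ∈ S × u ≢ x × ¬ (x ~ u)
        ∈C u∈C = ∈-comprehension⁻ nonneighbour? (C⊆ u∈C)
        boundary? : ∀ u → Dec (u ∈ S × u ∉ C × ∃[ c ] (c ∈ C × c ~ u))
        boundary? u = (u ∈? S) ×-dec ¬? (u ∈? C) ×-dec any? (λ c → (c ∈? C) ×-dec (c ~? u))
        L : Subset N
        L = comprehension boundary?
        ∈L : ∀ {u} → u ∈ L → u ∈ S × u ∉ C × ∃[ c ] (c ∈ C × c ~ u)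
        ∈L = ∈-comprehension⁻ boundary?
        -- A boundary vertex not adjacent to `x` would itself belong to the component.
        x~L : ∀ {u} → u ∈ L → x ~ u
        x~L {u} u∈L = let u∈S , u∉C , c , c∈C , c~u = ∈L u∈L in
          decidable-stable (x ~? u) λ x≁u → u∉C (closed c∈C
            (∈-comprehension⁺ nonneighbour?
              (u∈S , (λ { refl → proj₂ (proj₂ (∈C c∈C)) (~-sym c~u) }) , x≁u)) c~u)
        -- The two vertices are joined by an induced path through `C`. Both are neighbours of `x`,
        -- and no vertex of `C` is, so chordality leaves only a path of a single edge.
        L-clique : PairwiseAdjacent L
        L-clique a∈L b∈L a≢b =
          let _ , a∉C , c , c∈C , c~a = ∈L a∈L
              _ , b∉C , d , d∈C , d~b = ∈L b∈L
              _ , path = walk⇒inducedPath b∉C c∈C (connected c∈C d∈C) d~b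
              _ , path′ = extend path c∈C (~-sym c~a) a≢b
          in chordal⇒adjacent chordal (x~L a∈L) (x~L b∈L)
               (λ c∈C → let _ , c≢x , x≁c = ∈C c∈C in x≁c , c≢x ∘ sym) path′
        x∉T : x ∉ C ∪ L
        x∉T = ∉-∪ (λ x∈C → proj₁ (proj₂ (∈C x∈C)) refl) (λ x∈L → Graph.~-irr G (x~L x∈L))
        T<S : ∣ C ∪ L ∣ ℕ.< ∣ S ∣
        T<S = p⊂q⇒∣p∣<∣q∣ (∪-⊆ (proj₁ ∘ ∈C) (proj₁ ∘ ∈L) , x , x∈S , x∉T)
        N⊆T : ∀ {v a} → v ∈ C → a ∈ S → v ~ a → a ∈ C ∪ L
        N⊆T {a = a} v∈C a∈S v~a with a ∈? C
        ... | yes a∈C = p⊆p∪q L a∈C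
        ... | no  a∉C = q⊆p∪q C L (∈-comprehension⁺ boundary? (a∈S , a∉C , _ , v∈C , v~a))

    -- If `y` is not simplicial, it has non-adjacent neighbours `a` and `b`. If some `k` in `K`
    -- misses `a`, a simplicial vertex not adjacent to `k` is outside the clique `K`. Otherwise `K`
    -- lies in the closed neighbourhood of `a`, and a simplicial vertex not adjacent to `a` will do;
    -- `b` shows that `a` has a non-neighbour.
    simplicial-outside : ∀ S K {y} → Acc ℕ._<_ ∣ S ∣ → K ⊆ S → PairwiseAdjacent K →
                         y ∈ S → y ∉ K → SimplicialOutside S K
    simplicial-outside S K {y} (acc rs) K⊆S K-clique y∈S y∉K
      with any? (λ a → any? λ b → (a ∈? S) ×-dec (b ∈? S) ×-dec (y ~? a) ×-dec (y ~? b)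
                                  ×-dec ¬? (a ≟ᶠ b) ×-dec ¬? (a ~? b))
    ... | no simplicial = y , y∈S , y∉K , λ {a} {b} a∈S b∈S y~a y~b a≢b →
      decidable-stable (a ~? b) λ a≁b → simplicial (a , b , a∈S , b∈S , y~a , y~b , a≢b , a≁b)
    ... | yes (a , b , a∈S , b∈S , _ , _ , a≢b , a≁b)
      with any? (λ k → (k ∈? K) ×-dec ¬? (a ≟ᶠ k) ×-dec ¬? (k ~? a))
    ...   | yes (k , k∈K , a≢k , k≁a) =
      let v , v∈S , v≢k , k≁v , simplicial = simplicial-nonneighbour (K⊆S k∈K) a∈S a≢k k≁a
            (λ T L T<S → simplicial-outside T L (rs T<S))
      in v , v∈S , (λ v∈K → k≁v (K-clique k∈K v∈K (v≢k ∘ sym))) , simplicial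
    ...   | no K⊆N[a] =
      let v , v∈S , v≢a , a≁v , simplicial = simplicial-nonneighbour a∈S b∈S (a≢b ∘ sym) a≁b
            (λ T L T<S → simplicial-outside T L (rs T<S))
      in v , v∈S , (λ v∈K → K⊆N[a] (v , v∈K , v≢a ∘ sym , a≁v ∘ ~-sym)) , simplicial

    chordal⇒reduces : ∀ {S K} → Acc ℕ._<_ ∣ S ∣ → K ⊆ S → PairwiseAdjacent K → Reduces G K S
    chordal⇒reduces {S} {K} (acc rs) K⊆S K-clique with any? (λ y → (y ∈? S) ×-dec ¬? (y ∈? K))
    ... | no  S⊆K = done λ {y} y∈S → decidable-stable (y ∈? K) λ y∉K → S⊆K (y , y∈S , y∉K)
    ... | yes (y , y∈S , y∉K) =
      let v , v∈S , v∉K , simplicial = simplicial-outside S K (<-wellFounded _) K⊆S K-clique y∈S y∉K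
      in step v∈S v∉K simplicial (chordal⇒reduces (rs (x∈p⇒∣p-x∣<∣p∣ v∈S))
           (λ x∈K → x∈p∧x≢y⇒x∈p-y (K⊆S x∈K) λ { refl → v∉K x∈K }) K-clique)

-- Balanced clique separators

module _ {n} {S T : Subset n} where

  disjoint⁺ : (∀ {x} → x ∈ S → x ∉ T) → Disjoint S T
  disjoint⁺ f (x , x∈) = uncurry f (x∈p∩q⁻ S T x∈)

  disjoint⁻ : ∀ {x} → Disjoint S T → x ∈ S → x ∉ T
  disjoint⁻ S∩T x∈S x∈T = S∩T (_ , x∈p∩q⁺ (x∈S , x∈T))

disjoint-sym : ∀ {n} → Symmetric (Disjoint {n})
disjoint-sym S∩T = disjoint⁺ λ x∈T x∈S → disjoint⁻ S∩T x∈S x∈T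

disjoint-∪ : ∀ {n} {S T U : Subset n} → Disjoint S U → Disjoint T U → Disjoint (S ∪ T) U
disjoint-∪ {S = S} {T} S∩U T∩U = disjoint⁺ λ x∈ x∈U →
  [ (λ x∈S → disjoint⁻ S∩U x∈S x∈U) , (λ x∈T → disjoint⁻ T∩U x∈T x∈U) ]′ (x∈p∪q⁻ S T x∈)

disjoint-⊥ : ∀ {n} {S : Subset n} → Disjoint S ⊥
disjoint-⊥ = disjoint⁺ λ _ → ∉⊥

separated-sym : ∀ {G : Graph N} → Symmetric (Separated G)
separated-sym {G = G} sep u∈T v∈S u~v = sep v∈S u∈T (Graph.~-sym G u~v)

separated-∪ : ∀ {G : Graph N} {S T U} → Separated G S U → Separated G T U → Separated G (S ∪ T) U
separated-∪ {S = S} {T} S-U T-U u∈ v∈U =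
  [ (λ u∈S → S-U u∈S v∈U) , (λ u∈T → T-U u∈T v∈U) ]′ (x∈p∪q⁻ S T u∈)

separated-∪-All : ∀ {G : Graph N} {S T Us} → All (Separated G S) Us → All (Separated G T) Us →
                  All (Separated G (S ∪ T)) Us
separated-∪-All []          []          = []
separated-∪-All {G = G} (p ∷ ps) (q ∷ qs) = separated-∪ {G = G} p q ∷ separated-∪-All {G = G} ps qs

separated-⊥ : ∀ {G : Graph N} {S} → Separated G S ⊥
separated-⊥ _ v∈⊥ = ⊥-elim (∉⊥ v∈⊥)

∈-⋃⁺ : ∀ {n} {x : Fin n} {Ss} → Any (x ∈_) Ss → x ∈ ⋃ Ss
∈-⋃⁺ (here x∈)  = x∈p∪q⁺ (inj₁ x∈)
∈-⋃⁺ (there x∈) = x∈p∪q⁺ (inj₂ (∈-⋃⁺ x∈))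

∈-⋃⁻ : ∀ {n} {x : Fin n} Ss → x ∈ ⋃ Ss → Any (x ∈_) Ss
∈-⋃⁻ []       x∈ = ⊥-elim (∉⊥ x∈)
∈-⋃⁻ (S ∷ Ss) x∈ = [ here , there ∘ ∈-⋃⁻ Ss ]′ (x∈p∪q⁻ S _ x∈)

⋃-⊆ : ∀ {n} {T : Subset n} {Ss} → All (_⊆ T) Ss → ⋃ Ss ⊆ T
⋃-⊆ []           x∈ = ⊥-elim (∉⊥ x∈)
⋃-⊆ (S⊆T ∷ Ss⊆T) x∈ = ∪-⊆ S⊆T (⋃-⊆ Ss⊆T) x∈

allPairs-lookup : ∀ {A : Set} {_R_ : A → A → Set} {xs x y} → Symmetric _R_ → AllPairs _R_ xs →
                  x ∈ˡ xs → y ∈ˡ xs → x ≢ y → x R y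
allPairs-lookup _   _         (here refl) (here refl) x≢y = ⊥-elim (x≢y refl)
allPairs-lookup _   (Rxs ∷ _) (here refl) (there y∈)  _   = All.lookup Rxs y∈
allPairs-lookup sym (Rxs ∷ _) (there x∈)  (here refl) _   = sym (All.lookup Rxs x∈)
allPairs-lookup sym (_ ∷ Rxs) (there x∈)  (there y∈)  x≢y = allPairs-lookup sym Rxs x∈ y∈ x≢y

-- Half S stands for the condition that S has at most half of the weight.
module _ (H : Graph N) (Half : Subset N → Set) (Half? : ∀ S → Dec (Half S))
         (mono : ∀ {S T} → S ⊆ T → Half T → Half S)
         (halve : ∀ {S T} → Disjoint S T → Half S ⊎ Half T)
         where
  open Graph H using (_~_; ~-sym; ~⇒∈)

  half-⊥ : Half ⊥
  half-⊥ = [ id , id ]′ (halve {⊥} {⊥} disjoint-⊥)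

  -- In the second case the weight of `W` in `S` is not controlled, but `S ∪ X` weighs no more than
  -- a clique of `H`.
  Light : Subset N → Subset N → Set
  Light X S = Half S ⊎ IsClique H (S ∪ X)

  record BalancedSeparator : Set where
    field
      {X A B C}       : Subset N
      isDecomposition : IsDecomposition H X A B C
      X-clique        : IsClique H X
      A-light         : Light X A
      B-light         : Light X B
      C-light         : Light X C

  record Split (X : Subset N) (parts : List (Subset N)) : Set where
    constructor split
    field
      disjoint  : AllPairs Disjoint (X ∷ parts)
      separated : AllPairs (Separated H) parts
      within    : All (_⊆ V H) parts
      cover     : ∀ {u} → u ∈ V H → u ∈ X ⊎ Any (u ∈_) parts

  module _ {X} (X-clique : IsClique H X) where

    split⇒separator : ∀ {A B C} → Split X (A ∷ B ∷ C ∷ []) → Nonempty A → Nonempty B →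
                      Light X A → Light X B → Light X C → BalancedSeparator
    split⇒separator {A} {B} {C} (split disj sep within cover) A≢∅ B≢∅ A-light B-light C-light = record
      { isDecomposition = record
        { disjoint  = disj
        ; covers    = ⊆-antisym
            (⋃-⊆ ((λ {u} → proj₁ X-clique {u}) ∷ within))
            (λ u∈V → ∈-⋃⁺ ([ here , there ]′ (cover u∈V)))
        ; A≢∅       = A≢∅
        ; B≢∅       = B≢∅
        ; separated = sep
        }
      ; X-clique = X-clique
      ; A-light = A-light ; B-light = B-light ; C-light = C-light }

    -- Of two pairs of parts, one has at most half of the weight: merge it.
    merge : ∀ {A B C} L → Split X (A ∷ B ∷ C ∷ L) → Nonempty A → Nonempty B →
            All Half (A ∷ B ∷ C ∷ L) → BalancedSeparator
    merge [] s A≢∅ B≢∅ (a ∷ b ∷ c ∷ []) = split⇒separator s A≢∅ B≢∅ (inj₁ a) (inj₁ b) (inj₁ c)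
    merge {A} {B} {C} (D ∷ L)
      (split ((XA ∷ XB ∷ XC ∷ XD ∷ XL) ∷ (AB ∷ AC ∷ AD ∷ AL) ∷ (BC ∷ BD ∷ BL) ∷ (CD ∷ CL) ∷ DL ∷ LL)
             ((AB′ ∷ AC′ ∷ AD′ ∷ AL′) ∷ (BC′ ∷ BD′ ∷ BL′) ∷ (CD′ ∷ CL′) ∷ DL′ ∷ LL′)
             (A⊆V ∷ B⊆V ∷ C⊆V ∷ D⊆V ∷ L⊆V) cover)
      A≢∅ B≢∅ (a ∷ b ∷ c ∷ d ∷ l)
      -- Pairing `A` with `C` and `B` with `D` keeps the two parts known to be non-empty apart,
      -- whichever pair is merged.
      with halve {A ∪ C} {B ∪ D} (disjoint-sym (disjoint-∪ (disjoint-sym (disjoint-∪ AB (disjoint-sym BC)))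
                                                           (disjoint-sym (disjoint-∪ AD CD))))
    ... | inj₁ ac = merge L
      (split
        ((disjoint-sym (disjoint-∪ (disjoint-sym XA) (disjoint-sym XC)) ∷ XB ∷ XD ∷ XL)
          ∷ (disjoint-∪ AB (disjoint-sym BC) ∷ disjoint-∪ AD CD ∷ All.zipWith (uncurry disjoint-∪) (AL , CL))
          ∷ (BD ∷ BL) ∷ DL ∷ LL)
        ((separated-∪ {G = H} AB′ (separated-sym {G = H} BC′) ∷ separated-∪ {G = H} AD′ CD′
            ∷ separated-∪-All {G = H} AL′ CL′)
          ∷ (BD′ ∷ BL′) ∷ DL′ ∷ LL′)
        (∪-⊆ A⊆V C⊆V ∷ B⊆V ∷ D⊆V ∷ L⊆V)
        (Sum.map₂ regroup ∘ cover))
      (proj₁ A≢∅ , p⊆p∪q C (proj₂ A≢∅)) B≢∅ (ac ∷ b ∷ d ∷ l)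
      where
      regroup : ∀ {u} → Any (u ∈_) (A ∷ B ∷ C ∷ D ∷ L) → Any (u ∈_) (A ∪ C ∷ B ∷ D ∷ L)
      regroup (here u∈)                 = here (p⊆p∪q C u∈)
      regroup (there (here u∈))         = there (here u∈)
      regroup (there (there (here u∈))) = here (q⊆p∪q A C u∈)
      regroup (there (there (there u∈))) = there (there u∈)
    ... | inj₂ bd = merge L
      (split
        ((XA ∷ disjoint-sym (disjoint-∪ (disjoint-sym XB) (disjoint-sym XD)) ∷ XC ∷ XL)
          ∷ (disjoint-sym (disjoint-∪ (disjoint-sym AB) (disjoint-sym AD)) ∷ AC ∷ AL)
          ∷ (disjoint-∪ BC (disjoint-sym CD) ∷ All.zipWith (uncurry disjoint-∪) (BL , DL))
          ∷ CL ∷ LL)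
        ((separated-sym {G = H} (separated-∪ {G = H} (separated-sym {G = H} AB′) (separated-sym {G = H} AD′)) ∷ AC′ ∷ AL′)
          ∷ (separated-∪ {G = H} BC′ (separated-sym {G = H} CD′)
            ∷ separated-∪-All {G = H} BL′ DL′)
          ∷ CL′ ∷ LL′)
        (A⊆V ∷ ∪-⊆ B⊆V D⊆V ∷ C⊆V ∷ L⊆V)
        (Sum.map₂ regroup ∘ cover))
      A≢∅ (proj₁ B≢∅ , p⊆p∪q D (proj₂ B≢∅)) (a ∷ bd ∷ c ∷ l)
      where
      regroup : ∀ {u} → Any (u ∈_) (A ∷ B ∷ C ∷ D ∷ L) → Any (u ∈_) (A ∷ B ∪ D ∷ C ∷ L)
      regroup (here u∈)                 = here u∈
      regroup (there (here u∈))         = there (here (p⊆p∪q D u∈))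
      regroup (there (there (here u∈))) = there (there (here u∈))
      regroup (there (there (there (here u∈)))) = there (here (q⊆p∪q B D u∈))
      regroup (there (there (there (there u∈)))) = there (there (there u∈))

  -- A piece is what lies below a vertex of the elimination tree whose parent
  -- is not yet eliminated; its boundary is its neighbourhood, a clique.
  record Piece : Set where
    constructor piece
    field
      body boundary : Subset N

    outside-body : Subset N
    outside-body = V H ─ (body ∪ boundary)

  open Piece

  -- `far` records that the search did not stop at the piece. It bounds the body by one half,
  -- through `halve`, and shows that something lies beyond the piece.
  record IsPiece (R : Subset N) (p : Piece) : Set where
    field
      nonempty        : Nonempty (body p)
      body⊆V          : body p ⊆ V H
      eliminated      : Disjoint (body p) R
      boundary⊆R      : boundary p ⊆ R
      boundary-clique : IsClique H (boundary p)
      neighbours      : ∀ {u x} → u ∈ body p → u ~ x → x ∈ body p ⊎ x ∈ boundary p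
      far             : ¬ Half (outside-body p)

  module _ {R p} (isPiece : IsPiece R p) where
    open IsPiece isPiece

    body-outside : Disjoint (body p) (outside-body p)
    body-outside = disjoint⁺ λ u∈ u∈O → x∈p─q⇒x∉q (V H) _ u∈O (p⊆p∪q _ u∈)

    body-half : Half (body p)
    body-half = [ id , (λ h → ⊥-elim (far h)) ]′ (halve body-outside)

    outside-nonempty : Nonempty (outside-body p)
    outside-nonempty with nonempty? (outside-body p)
    ... | yes O≢∅ = O≢∅
    ... | no  O≡∅ = ⊥-elim (far (subst Half (sym (Empty-unique O≡∅)) half-⊥))

    body-separated : ∀ {S} → Disjoint (body p) S → Disjoint S (boundary p) → Separated H (body p) S
    body-separated p∩S S∩B u∈ x∈S u~x =
      [ (λ x∈p → disjoint⁻ p∩S x∈p x∈S) , (λ x∈B → disjoint⁻ S∩B x∈S x∈B) ]′ (neighbours u∈ u~x)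

    -- An edge leaving `p` ends in its boundary, hence in `R`, whereas `q` has been eliminated.
    pieces-separated : ∀ {q} → IsPiece R q → Disjoint (body p) (body q) → Separated H (body p) (body q)
    pieces-separated q p∩q = body-separated p∩q
      (disjoint⁺ λ x∈q x∈B → disjoint⁻ (IsPiece.eliminated q) x∈q (boundary⊆R x∈B))

  _#_ : Piece → Piece → Set
  p # q = Disjoint (body p) (body q)

  module _ (V-not-clique : ¬ IsClique H (V H)) where

    -- Two non-empty parts are sought among the pieces `ts` and the rest `O`. Two pieces suffice,
    -- and so does one piece with a non-empty `O`. A single piece with empty `O` is split off along
    -- its own boundary, since all that lies beyond it is in the clique `X`. With no piece, `O` is
    -- non-empty because `V H` is not a clique, and the caller supplies the separator.
    assemble : ∀ {R X O} ts → X ⊆ R → IsClique H X → All (IsPiece R) ts → AllPairs _#_ ts →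
               All (λ p → boundary p ⊆ X) ts →
               O ⊆ V H → Disjoint X O → All (λ p → Disjoint (body p) O) ts → Half O →
               (∀ {u} → u ∈ V H → u ∈ X ⊎ u ∈ O ⊎ Any (λ p → u ∈ body p) ts) →
               (ts ≡ [] → Nonempty O → BalancedSeparator) → BalancedSeparator
    assemble {X = X} {O} [] X⊆R X-clique _ _ _ _ _ _ _ cover pendant with nonempty? O
    ... | yes O≢∅ = pendant refl O≢∅
    ... | no  O≡∅ = ⊥-elim (V-not-clique (IsClique-⊆ {G = H} X-clique λ u∈V →
      [ id , [ (λ u∈O → ⊥-elim (O≡∅ (_ , u∈O))) , (λ ()) ]′ ]′ (cover u∈V)))
    assemble {R} {X} {O} (p ∷ []) X⊆R X-clique (isPiece ∷ []) _ (B⊆X ∷ []) O⊆V X∩O (p∩O ∷ []) O-half cover _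
      with nonempty? O
    ... | yes O≢∅ = split⇒separator X-clique
      (split
        ((disjoint-sym (disjoint⁺ λ u∈p u∈X → disjoint⁻ eliminated u∈p (X⊆R u∈X)) ∷ X∩O ∷ disjoint-⊥ ∷ [])
          ∷ (p∩O ∷ disjoint-⊥ ∷ []) ∷ (disjoint-⊥ ∷ []) ∷ [] ∷ [])
        (((λ {u} {v} → body-separated isPiece p∩O (disjoint⁺ λ u∈O u∈B → disjoint⁻ X∩O (B⊆X u∈B) u∈O) {u} {v})
            ∷ separated-⊥ {G = H} ∷ [])
          ∷ (separated-⊥ {G = H} ∷ []) ∷ [] ∷ [])
        ((λ {u} → body⊆V {u}) ∷ (λ {u} → O⊆V {u}) ∷ ⊥⊆ ∷ [])
        λ u∈V → Sum.map₂ (λ { (inj₁ u∈O) → there (here u∈O) ; (inj₂ (here u∈p)) → here u∈p }) (cover u∈V))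
      nonempty O≢∅ (inj₁ (body-half isPiece)) (inj₁ O-half) (inj₁ (mono ⊥⊆ O-half))
      where open IsPiece isPiece
    -- Here the piece and X cover all vertices.
    ... | no  O≡∅ = split⇒separator boundary-clique
      (split
        ((disjoint⁺ (λ u∈B u∈p → disjoint⁻ eliminated u∈p (boundary⊆R u∈B))
            ∷ disjoint⁺ (λ u∈B u∈O → x∈p─q⇒x∉q (V H) _ u∈O (q⊆p∪q (body p) _ u∈B)) ∷ disjoint-⊥ ∷ [])
          ∷ (body-outside isPiece ∷ disjoint-⊥ ∷ []) ∷ (disjoint-⊥ ∷ []) ∷ [] ∷ [])
        (((λ {u} {v} → body-separated isPiece (body-outside isPiece)
              (disjoint⁺ λ u∈O u∈B → x∈p─q⇒x∉q (V H) _ u∈O (q⊆p∪q (body p) _ u∈B)) {u} {v})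
            ∷ separated-⊥ {G = H} ∷ [])
          ∷ (separated-⊥ {G = H} ∷ []) ∷ [] ∷ [])
        ((λ {u} → body⊆V {u}) ∷ (λ {u} → p─q⊆p (V H) (body p ∪ boundary p) {u}) ∷ ⊥⊆ ∷ [])
        cover′)
      nonempty (outside-nonempty isPiece) (inj₁ (body-half isPiece))
      (inj₂ (IsClique-⊆ {G = H} X-clique (∪-⊆ O⊆X B⊆X))) (inj₁ (mono ⊥⊆ O-half))
      where
      open IsPiece isPiece
      O⊆X : outside-body p ⊆ X
      O⊆X u∈ with cover (p─q⊆p (V H) _ u∈)
      ... | inj₁ u∈X               = u∈X
      ... | inj₂ (inj₁ u∈O)        = ⊥-elim (O≡∅ (_ , u∈O))
      ... | inj₂ (inj₂ (here u∈p)) = ⊥-elim (disjoint⁻ (body-outside isPiece) u∈p u∈)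
      cover′ : ∀ {u} → u ∈ V H → u ∈ boundary p ⊎ Any (u ∈_) (body p ∷ outside-body p ∷ ⊥ ∷ [])
      cover′ {u} u∈V with u ∈? body p | u ∈? boundary p
      ... | _       | yes u∈B = inj₁ u∈B
      ... | yes u∈p | no  _   = inj₂ (here u∈p)
      ... | no  u∉p | no  u∉B = inj₂ (there (here (x∈p∧x∉q⇒x∈p─q u∈V (∉-∪ u∉p u∉B))))
    assemble {R} {X} {O} (p ∷ q ∷ ts) X⊆R X-clique (p-piece ∷ q-piece ∷ ts-pieces)
      ((pq ∷ pts) ∷ (qts ∷ tts)) (p⊆X ∷ q⊆X ∷ ts⊆X) O⊆V X∩O (p∩O ∷ q∩O ∷ ts∩O) O-half cover _ =
      merge X-clique (map body ts)
        (split
          ((X∩ p-piece ∷ X∩ q-piece ∷ X∩O ∷ All.map⁺ (All.map X∩ ts-pieces))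
            ∷ (pq ∷ p∩O ∷ All.map⁺ pts) ∷ (q∩O ∷ All.map⁺ qts)
            ∷ All.map⁺ (All.map disjoint-sym ts∩O) ∷ AllPairs.map⁺ tts)
          (((λ {u} {v} → pieces-separated p-piece q-piece pq {u} {v})
              ∷ (λ {u} {v} → from-O p-piece p⊆X p∩O {u} {v}) ∷ separated-pieces p-piece ts-pieces pts)
            ∷ ((λ {u} {v} → from-O q-piece q⊆X q∩O {u} {v}) ∷ separated-pieces q-piece ts-pieces qts)
            ∷ O-pieces ts-pieces ts⊆X ts∩O ∷ all-pieces ts-pieces tts)
          ((λ {u} → IsPiece.body⊆V p-piece {u}) ∷ (λ {u} → IsPiece.body⊆V q-piece {u}) ∷ (λ {u} → O⊆V {u})
            ∷ bodies⊆V ts-pieces)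
          (Sum.map₂ place ∘ cover))
        (IsPiece.nonempty p-piece) (IsPiece.nonempty q-piece)
        (body-half p-piece ∷ body-half q-piece ∷ O-half ∷ All.map⁺ (All.map body-half ts-pieces))
      where
      X∩ : ∀ {t} → IsPiece R t → Disjoint X (body t)
      X∩ t = disjoint⁺ λ u∈X u∈t → disjoint⁻ (IsPiece.eliminated t) u∈t (X⊆R u∈X)
      from-O : ∀ {t} → IsPiece R t → boundary t ⊆ X → Disjoint (body t) O → Separated H (body t) O
      from-O t B⊆X t∩O = body-separated t t∩O (disjoint⁺ λ u∈O u∈B → disjoint⁻ X∩O (B⊆X u∈B) u∈O)
      separated-pieces : ∀ {t ts} → IsPiece R t → All (IsPiece R) ts → All (t #_) ts →
                         All (Separated H (body t)) (map body ts)
      separated-pieces _ []       []       = []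
      separated-pieces t (s ∷ ss) (d ∷ ds) = pieces-separated t s d ∷ separated-pieces t ss ds
      O-pieces : ∀ {ts} → All (IsPiece R) ts → All (λ p → boundary p ⊆ X) ts →
                 All (λ p → Disjoint (body p) O) ts → All (Separated H O) (map body ts)
      O-pieces []       []         []       = []
      O-pieces (t ∷ ts) (B⊆ ∷ Bs⊆) (d ∷ ds) =
        separated-sym {G = H} (from-O t B⊆ d) ∷ O-pieces ts Bs⊆ ds
      all-pieces : ∀ {ts} → All (IsPiece R) ts → AllPairs _#_ ts → AllPairs (Separated H) (map body ts)
      all-pieces []       []       = []
      all-pieces (t ∷ ts) (d ∷ ds) = separated-pieces t ts d ∷ all-pieces ts ds
      bodies⊆V : ∀ {ts} → All (IsPiece R) ts → All (_⊆ V H) (map body ts)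
      bodies⊆V []       = []
      bodies⊆V (t ∷ ts) = IsPiece.body⊆V t ∷ bodies⊆V ts
      place : ∀ {u} → u ∈ O ⊎ Any (λ p → u ∈ body p) (p ∷ q ∷ ts) →
              Any (u ∈_) (body p ∷ body q ∷ O ∷ map body ts)
      place (inj₁ u∈O)                = there (there (here u∈O))
      place (inj₂ (here u∈))          = here u∈
      place (inj₂ (there (here u∈)))  = there (here u∈)
      place (inj₂ (there (there u∈))) = there (there (there (Any.map⁺ u∈)))

    record Decomposed (R : Subset N) (ps : List Piece) : Set where
      field
        R⊆V      : R ⊆ V H
        pieces   : All (IsPiece R) ps
        disjoint : AllPairs _#_ ps
        cover    : ∀ {u} → u ∈ V H → u ∈ R ⊎ Any (λ p → u ∈ body p) ps

    module Eliminate {R ps v} (decomposed : Decomposed R ps) (v∈R : v ∈ R)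
                     (simplicial : Simplicial H R v) where
      open Decomposed decomposed

      touches? : ∀ p → Dec (v ∈ boundary p)
      touches? p = v ∈? boundary p

      touch rest : List Piece
      touch = filter touches? ps
      rest  = filter (¬? ∘ touches?) ps

      -- `B` consists of the later neighbours of `v`; `P` joins `v` to the pieces attached to it,
      -- and `O` is what lies beyond. As `O` is the `outside-body` of `piece P B`, failure of the
      -- stopping test is exactly `far` for the new piece.
      B X P O : Subset N
      B = R ∩ Graph.N[_] H v
      X = ⁅ v ⁆ ∪ B
      P = ⁅ v ⁆ ∪ ⋃ (map body touch)
      O = V H ─ (P ∪ B)

      ∈-B⁺ : ∀ {u} → u ∈ R → v ~ u → u ∈ B
      ∈-B⁺ u∈R v~u = x∈p∩q⁺ (u∈R , ∈-N⁺ H v~u)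

      ∈-B⁻ : ∀ {u} → u ∈ B → u ∈ R × v ~ u
      ∈-B⁻ u∈B = let u∈R , u∈N = x∈p∩q⁻ R _ u∈B in u∈R , ∈-N⁻ H u∈N

      v∉B : v ∉ B
      v∉B v∈B = Graph.~-irr H (proj₂ (∈-B⁻ v∈B))

      ∈-X⁻ : ∀ {u} → u ∈ X → u ≡ v ⊎ u ∈ B
      ∈-X⁻ u∈X = Sum.map₁ (x∈⁅y⁆⇒x≡y v) (x∈p∪q⁻ ⁅ v ⁆ B u∈X)

      v∈X : v ∈ X
      v∈X = p⊆p∪q B (x∈⁅x⁆ v)

      X⊆R : X ⊆ R
      X⊆R = ∪-⊆ (λ u∈ → subst (_∈ R) (sym (x∈⁅y⁆⇒x≡y v u∈)) v∈R) (proj₁ ∘ ∈-B⁻)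

      X-clique : IsClique H X
      X-clique = R⊆V ∘ X⊆R , λ a∈X b∈X → adjacent (∈-X⁻ a∈X) (∈-X⁻ b∈X)
        where
        adjacent : ∀ {a b} → a ≡ v ⊎ a ∈ B → b ≡ v ⊎ b ∈ B → a ≢ b → a ~ b
        adjacent (inj₁ refl) (inj₁ refl) a≢b = ⊥-elim (a≢b refl)
        adjacent (inj₁ refl) (inj₂ b∈B)  _   = proj₂ (∈-B⁻ b∈B)
        adjacent (inj₂ a∈B)  (inj₁ refl) _   = ~-sym (proj₂ (∈-B⁻ a∈B))
        adjacent (inj₂ a∈B)  (inj₂ b∈B)  a≢b =
          let a∈R , v~a = ∈-B⁻ a∈B ; b∈R , v~b = ∈-B⁻ b∈B in simplicial a∈R b∈R v~a v~b a≢b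

      B-clique : IsClique H B
      B-clique = IsClique-⊆ {G = H} X-clique (q⊆p∪q ⁅ v ⁆ B)

      ∈-touch⁻ : ∀ {p} → p ∈ˡ touch → p ∈ˡ ps × v ∈ boundary p
      ∈-touch⁻ = ∈-filter⁻ touches?

      ∈-rest⁻ : ∀ {p} → p ∈ˡ rest → p ∈ˡ ps × v ∉ boundary p
      ∈-rest⁻ = ∈-filter⁻ (¬? ∘ touches?)

      isPiece : ∀ {p} → p ∈ˡ ps → IsPiece R p
      isPiece = All.lookup pieces

      ∈-P⁻ : ∀ {u} → u ∈ P → u ≡ v ⊎ ∃[ p ] (p ∈ˡ touch × u ∈ body p)
      ∈-P⁻ u∈P = Sum.map (x∈⁅y⁆⇒x≡y v) (find ∘ Any.map⁻ ∘ ∈-⋃⁻ (map body touch))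
        (x∈p∪q⁻ ⁅ v ⁆ _ u∈P)

      touch⊆P : ∀ {p} → p ∈ˡ touch → body p ⊆ P
      touch⊆P p∈ u∈p = q⊆p∪q ⁅ v ⁆ _ (∈-⋃⁺ (Any.map⁺ (lose p∈ u∈p)))

      v∈P : v ∈ P
      v∈P = p⊆p∪q _ (x∈⁅x⁆ v)

      -- The boundary is a clique in `R` through `v`, so its other vertices are later neighbours of
      -- `v`.
      boundary⊆X : ∀ {p} → p ∈ˡ touch → boundary p ⊆ X
      boundary⊆X p∈ {u} u∈B with ∈-touch⁻ p∈ | u ≟ᶠ v
      ... | _          | yes refl = v∈X
      ... | p∈ps , v∈B | no  u≢v  = q⊆p∪q ⁅ v ⁆ B (∈-B⁺ (boundary⊆R u∈B)
        (proj₂ boundary-clique v∈B u∈B (u≢v ∘ sym)))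
        where open IsPiece (isPiece p∈ps)

      -- The delicate case is an edge from `v` to an eliminated vertex `x`: as `v` is still in `R`,
      -- it lies in the boundary of the piece of `x`, which is therefore part of `P`.
      P-neighbours : ∀ {u x} → u ∈ P → u ~ x → x ∈ P ⊎ x ∈ B
      P-neighbours {x = x} u∈P u~x with ∈-P⁻ u∈P
      ... | inj₂ (p , p∈ , u∈p) with IsPiece.neighbours (isPiece (proj₁ (∈-touch⁻ p∈))) u∈p u~x
      ...   | inj₁ x∈p = inj₁ (touch⊆P p∈ x∈p)
      ...   | inj₂ x∈B with ∈-X⁻ (boundary⊆X p∈ x∈B)
      ...     | inj₁ refl = inj₁ v∈P
      ...     | inj₂ x∈B  = inj₂ x∈B
      P-neighbours {x = x} u∈P v~x | inj₁ refl with cover (~⇒∈ʳ H v~x)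
      ... | inj₁ x∈R = inj₂ (∈-B⁺ x∈R v~x)
      ... | inj₂ x∈ps with find x∈ps
      ...   | p , p∈ , x∈p with IsPiece.neighbours (isPiece p∈) x∈p (~-sym v~x)
      ...     | inj₁ v∈p = ⊥-elim (disjoint⁻ (IsPiece.eliminated (isPiece p∈)) v∈p v∈R)
      ...     | inj₂ v∈B = inj₁ (touch⊆P (∈-filter⁺ touches? p∈ v∈B) x∈p)

      O⊆V : O ⊆ V H
      O⊆V = p─q⊆p (V H) (P ∪ B)

      P∩O : Disjoint P O
      P∩O = disjoint⁺ λ u∈P u∈O → x∈p─q⇒x∉q (V H) _ u∈O (p⊆p∪q B u∈P)

      B∩O : Disjoint B O
      B∩O = disjoint⁺ λ u∈B u∈O → x∈p─q⇒x∉q (V H) _ u∈O (q⊆p∪q P B u∈B)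

      X∩O : Disjoint X O
      X∩O = disjoint⁺ λ u∈X u∈O → [ (λ { refl → disjoint⁻ P∩O v∈P u∈O })
        , (λ u∈B → disjoint⁻ B∩O u∈B u∈O) ]′ (∈-X⁻ u∈X)

      P-B-O : ∀ {u} → u ∈ V H → u ∈ P ⊎ u ∈ B ⊎ u ∈ O
      P-B-O {u} u∈V with u ∈? P | u ∈? B
      ... | yes u∈P | _       = inj₁ u∈P
      ... | no  _   | yes u∈B = inj₂ (inj₁ u∈B)
      ... | no  u∉P | no  u∉B = inj₂ (inj₂ (x∈p∧x∉q⇒x∈p─q u∈V (∉-∪ u∉P u∉B)))

      P⊆V : P ⊆ V H
      P⊆V u∈P with ∈-P⁻ u∈P
      ... | inj₁ refl           = R⊆V v∈R
      ... | inj₂ (p , p∈ , u∈p) = IsPiece.body⊆V (isPiece (proj₁ (∈-touch⁻ p∈))) u∈p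

      -- Without attached pieces, `P` is just `v`. Separating along `B` instead of `X` makes `v` a
      -- part of its own, which forms the clique `X` with the separator, however heavy `v` is.
      pendant : Half O → touch ≡ [] → Nonempty O → BalancedSeparator
      pendant O-half touch≡[] O≢∅ = split⇒separator B-clique
        (split
          ((disjoint⁺ (λ u∈B u∈v → v∉B (subst (_∈ B) (x∈⁅y⁆⇒x≡y v u∈v) u∈B)) ∷ B∩O ∷ disjoint-⊥ ∷ [])
            ∷ (disjoint⁺ (λ u∈v → disjoint⁻ P∩O (p⊆p∪q _ u∈v)) ∷ disjoint-⊥ ∷ [])
            ∷ (disjoint-⊥ ∷ []) ∷ [] ∷ [])
          (((λ {a} {b} → sep {a} {b}) ∷ separated-⊥ {G = H} ∷ []) ∷ (separated-⊥ {G = H} ∷ []) ∷ [] ∷ [])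
          ((λ {u} u∈v → P⊆V {u} (p⊆p∪q _ u∈v)) ∷ (λ {u} → O⊆V {u}) ∷ ⊥⊆ ∷ [])
          (λ u∈V → [ inj₂ ∘ here ∘ P⊆⁅v⁆ , [ inj₁ , (λ u∈O → inj₂ (there (here u∈O))) ]′ ]′ (P-B-O u∈V)))
        (v , x∈⁅x⁆ v) O≢∅ (inj₂ X-clique) (inj₁ O-half) (inj₁ (mono ⊥⊆ O-half))
        where
        P⊆⁅v⁆ : P ⊆ ⁅ v ⁆
        P⊆⁅v⁆ = ∪-⊆ id λ u∈ → ⊥-elim (∉⊥ (subst (λ ts → _ ∈ ⋃ (map body ts)) touch≡[] u∈))
        sep : Separated H ⁅ v ⁆ O
        sep u∈v x∈O u~x = [ (λ x∈P → disjoint⁻ P∩O x∈P x∈O) , (λ x∈B → disjoint⁻ B∩O x∈B x∈O) ]′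
          (P-neighbours (p⊆p∪q _ u∈v) u~x)

      stop : Half O → BalancedSeparator
      stop O-half = assemble touch X⊆R X-clique
        (All.filter⁺ touches? pieces)
        (AllPairs.filter⁺ touches? disjoint)
        (All.tabulate λ p∈ → boundary⊆X p∈)
        O⊆V X∩O
        (All.tabulate λ p∈ → disjoint⁺ λ u∈p → disjoint⁻ P∩O (touch⊆P p∈ u∈p))
        O-half
        (λ u∈V → [ [ (λ { refl → inj₁ v∈X }) , (λ (p , p∈ , u∈p) → inj₂ (inj₂ (lose p∈ u∈p))) ]′ ∘ ∈-P⁻
                 , [ inj₁ ∘ q⊆p∪q ⁅ v ⁆ B , inj₂ ∘ inj₁ ]′ ]′ (P-B-O u∈V))
        (pendant O-half)

      P-isPiece : ¬ Half O → IsPiece (R - v) (piece P B)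
      P-isPiece far = record
        { nonempty        = v , v∈P
        ; body⊆V          = P⊆V
        ; eliminated      = disjoint⁺ λ u∈P u∈ → let u∈R , u≢v = x∈p-y⁻ R v u∈ in
            [ u≢v , (λ (p , p∈ , u∈p) →
              disjoint⁻ (IsPiece.eliminated (isPiece (proj₁ (∈-touch⁻ p∈)))) u∈p u∈R) ]′ (∈-P⁻ u∈P)
        ; boundary⊆R      = λ u∈B → x∈p∧x≢y⇒x∈p-y (proj₁ (∈-B⁻ u∈B)) λ { refl → v∉B u∈B }
        ; boundary-clique = B-clique
        ; neighbours      = P-neighbours
        ; far             = far
        }

      rest-isPiece : ∀ {p} → p ∈ˡ rest → IsPiece (R - v) p
      rest-isPiece p∈ = record
        { nonempty        = nonempty
        ; body⊆V          = body⊆V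
        ; eliminated      = disjoint⁺ λ u∈p u∈ → disjoint⁻ eliminated u∈p (proj₁ (x∈p-y⁻ R v u∈))
        ; boundary⊆R      = λ u∈B → x∈p∧x≢y⇒x∈p-y (boundary⊆R u∈B) λ { refl → proj₂ (∈-rest⁻ p∈) u∈B }
        ; boundary-clique = boundary-clique
        ; neighbours      = neighbours
        ; far             = far
        }
        where open IsPiece (isPiece (proj₁ (∈-rest⁻ p∈)))

      P#rest : ∀ {q} → q ∈ˡ rest → Disjoint P (body q)
      P#rest {q} q∈ = disjoint⁺ λ u∈P u∈q → [ (λ { refl → disjoint⁻ (IsPiece.eliminated (isPiece q∈ps)) u∈q v∈R })
        , (λ (p , p∈ , u∈p) → disjoint⁻
            (allPairs-lookup disjoint-sym disjoint (proj₁ (∈-touch⁻ p∈)) q∈ps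
              λ { refl → v∉B′ (proj₂ (∈-touch⁻ p∈)) }) u∈p u∈q) ]′ (∈-P⁻ u∈P)
        where
        q∈ps : q ∈ˡ ps
        q∈ps = proj₁ (∈-rest⁻ q∈)
        v∉B′ : v ∉ boundary q
        v∉B′ = proj₂ (∈-rest⁻ q∈)

      continue : ¬ Half O → Decomposed (R - v) (piece P B ∷ rest)
      continue far = record
        { R⊆V      = λ u∈ → R⊆V (proj₁ (x∈p-y⁻ R v u∈))
        ; pieces   = P-isPiece far ∷ All.tabulate rest-isPiece
        ; disjoint = All.tabulate P#rest ∷ AllPairs.filter⁺ (¬? ∘ touches?) disjoint
        ; cover    = λ u∈V → [ cover-R , cover-ps ∘ find ]′ (cover u∈V)
        }
        where
        Covered : Fin N → Set
        Covered u = u ∈ R - v ⊎ Any (λ p → u ∈ body p) (piece P B ∷ rest)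
        cover-R : ∀ {u} → u ∈ R → Covered u
        cover-R {u} u∈R with u ≟ᶠ v
        ... | yes refl = inj₂ (here v∈P)
        ... | no  u≢v  = inj₁ (x∈p∧x≢y⇒x∈p-y u∈R u≢v)
        cover-ps : ∀ {u} → ∃[ p ] (p ∈ˡ ps × u ∈ body p) → Covered u
        cover-ps (p , p∈ , u∈p) with touches? p
        ... | yes v∈B = inj₂ (here (touch⊆P (∈-filter⁺ touches? p∈ v∈B) u∈p))
        ... | no  v∉B = inj₂ (there (lose (∈-filter⁺ (¬? ∘ touches?) p∈ v∉B) u∈p))

    eliminate : ∀ {R ps} → Reduces H ⊥ R → Decomposed R ps → BalancedSeparator
    -- The search never stopped: all boundaries are empty, so the pieces are separated by the empty
    -- clique.
    eliminate {R} {ps} (done R⊆⊥) decomposed = assemble ps ⊥⊆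
      ((λ u∈⊥ → ⊥-elim (∉⊥ u∈⊥)) , (λ u∈⊥ → ⊥-elim (∉⊥ u∈⊥)))
      pieces disjoint
      (All.map (λ p {u} u∈B → R⊆⊥ (IsPiece.boundary⊆R p u∈B)) pieces)
      ⊥⊆ disjoint-⊥ (All.map (λ _ → disjoint-⊥) pieces) half-⊥
      (λ u∈V → [ inj₁ ∘ R⊆⊥ , inj₂ ∘ inj₂ ]′ (cover u∈V))
      (λ _ (u , u∈⊥) → ⊥-elim (∉⊥ u∈⊥))
      where
      open Decomposed decomposed
    eliminate (step v∈R _ simplicial reduces) decomposed with Half? (Eliminate.O decomposed v∈R simplicial)
    ... | yes O-half = Eliminate.stop decomposed v∈R simplicial O-half
    ... | no  far    = eliminate reduces (Eliminate.continue decomposed v∈R simplicial far)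

    balancedSeparator : Reduces H ⊥ (V H) → BalancedSeparator
    balancedSeparator reduces = eliminate {ps = []} reduces (record
      { R⊆V = id ; pieces = [] ; disjoint = [] ; cover = inj₁ })

-- Building triangulations

triangulation-reduces : ∀ {G H : Graph N} → IsTriangulation G H → Reduces H ⊥ (V H)
triangulation-reduces {H = H} H-tri = chordal⇒reduces H (IsTriangulation.chordal H-tri)
  (<-wellFounded _) ⊥⊆ λ u∈⊥ → ⊥-elim (∉⊥ u∈⊥)

clique-reduces : ∀ (G : Graph N) {S} → Acc ℕ._<_ ∣ S ∣ → PairwiseAdjacent G S → Reduces G ⊥ S
clique-reduces G {S} (acc rs) S-clique with nonempty? S
... | no  S≡∅       = done λ v∈S → ⊥-elim (S≡∅ (_ , v∈S))
... | yes (v , v∈S) = step v∈S ∉⊥ (λ a∈S b∈S _ _ → S-clique a∈S b∈S)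
  (clique-reduces G (rs (x∈p⇒∣p-x∣<∣p∣ v∈S)) λ a∈ b∈ → S-clique (p─q⊆p S _ a∈) (p─q⊆p S _ b∈))

-- A cycle of the induced subgraph has a chord in `H`, and the ends of the chord lie on the cycle,
-- hence in `S`.
[]-triangulation : ∀ {G H : Graph N} S → IsTriangulation G H → IsTriangulation (G [ S ]) (H [ S ])
[]-triangulation S H-tri = record
  { sameVertices = cong (_∩ S) sameVertices
  ; addsEdges    = λ (u~v , u∈S , v∈S) → addsEdges u~v , u∈S , v∈S
  ; chordal      = λ 3≤k c →
      let open Cycle c
          i , j , j≢ , i≢ , i~j = chordal 3≤k (record
            { vertex = vertex ; injective = injective ; adjacent = proj₁ ∘ adjacent })
      in i , j , j≢ , i≢ , i~j , proj₁ (proj₂ (adjacent i)) , proj₁ (proj₂ (adjacent j))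
  }
  where open IsTriangulation H-tri

∈-V[]⁻ : ∀ (G : Graph N) S {u} → u ∈ V (G [ S ]) → u ∈ V G × u ∈ S
∈-V[]⁻ G S = x∈p∩q⁻ (V G) S

[]-clique : ∀ {H : Graph N} {S Q} → IsClique (H [ S ]) Q → IsClique H Q
[]-clique {H = H} {S} (Q⊆V , adj) =
  (λ u∈Q → proj₁ (∈-V[]⁻ H S (Q⊆V u∈Q))) , λ u∈Q v∈Q u≢v → proj₁ (adj u∈Q v∈Q u≢v)

-- One step of vertex elimination, shared by the fill-in of the algorithm and the construction of an
-- optimal triangulation.
module Fill {N : ℕ} (G : Graph N) {v : Fin N} (v∈V : v ∈ V G) where

  G′ filled : Graph N
  G′     = makeClique G (Graph.N[_] G v)
  filled = G′ [ ∁ ⁅ v ⁆ ]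

  filled⁺ : ∀ {a b} → a ≢ v → b ≢ v → a ~⟨ G′ ⟩ b → a ~⟨ filled ⟩ b
  filled⁺ a≢v b≢v a~b = a~b , x∉p⇒x∈∁p (x≢y⇒x∉⁅y⁆ a≢v) , x∉p⇒x∈∁p (x≢y⇒x∉⁅y⁆ b≢v)

  N⊆V : ∀ {a} → v ~⟨ G ⟩ a → a ∈ V G ∩ Graph.N[_] G v
  N⊆V v~a = x∈p∩q⁺ (~⇒∈ʳ G v~a , ∈-N⁺ G v~a)

  module _ {H : Graph N} (H-tri : IsTriangulation filled H) where
    open IsTriangulation H-tri

    ∈-VH⁻ : ∀ {u} → u ∈ V H → u ∈ V G × u ≢ v
    ∈-VH⁻ u∈ = let u∈V , u∈∁v = x∈p∩q⁻ (V G) _ (subst (_ ∈_) sameVertices u∈) in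
      u∈V , λ { refl → x∈∁p⇒x∉p u∈∁v (x∈⁅x⁆ v) }

    ∈-VH⁺ : ∀ {u} → u ∈ V G → u ≢ v → u ∈ V H
    ∈-VH⁺ u∈V u≢v = subst (_ ∈_) (sym sameVertices)
      (x∈p∩q⁺ (u∈V , x∉p⇒x∈∁p (x≢y⇒x∉⁅y⁆ u≢v)))

    V-fill : V (G′ ∪ᴳ H) ≡ V G
    V-fill = ⊆-antisym (∪-⊆ id (proj₁ ∘ ∈-VH⁻)) (p⊆p∪q (V H))

    -- New edges join neighbours of `v` or come from `H`, and `v` is neither its own neighbour nor a
    -- vertex of `H`.
    fill-neighbour : ∀ {a} → v ~⟨ G′ ∪ᴳ H ⟩ a → v ~⟨ G ⟩ a
    fill-neighbour (inj₁ (inj₁ v~a))          = v~a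
    fill-neighbour (inj₁ (inj₂ (v∈ , _ , _))) =
      ⊥-elim (Graph.~-irr G (∈-N⁻ G (proj₂ (x∈p∩q⁻ (V G) _ v∈))))
    fill-neighbour (inj₂ v~a)                 = ⊥-elim (proj₂ (∈-VH⁻ (Graph.~⇒∈ H v~a)) refl)

    fill-rest : ∀ {a b} → a ≢ v → b ≢ v → a ~⟨ G′ ∪ᴳ H ⟩ b → a ~⟨ H ⟩ b
    fill-rest a≢v b≢v (inj₁ a~b) = addsEdges (filled⁺ a≢v b≢v a~b)
    fill-rest _   _   (inj₂ a~b) = a~b

    fill-reduces : Reduces (G′ ∪ᴳ H) ⊥ (V (G′ ∪ᴳ H))
    fill-reduces = step (p⊆p∪q _ v∈V) ∉⊥
      (λ _ _ v~a v~b a≢b → inj₁ (inj₂ (N⊆V (fill-neighbour v~a) , N⊆V (fill-neighbour v~b) , a≢b)))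
      (reduces-⊆ (triangulation-reduces H-tri)
        (λ u∈ → let u∈VU , u≢v = x∈p-y⁻ (V (G′ ∪ᴳ H)) v u∈ in
          ∈-VH⁺ (subst (_ ∈_) V-fill u∈VU) u≢v)
        (λ _ _ → inj₂)
        (λ a∈ b∈ → fill-rest (proj₂ (x∈p-y⁻ (V (G′ ∪ᴳ H)) v a∈)) (proj₂ (x∈p-y⁻ (V (G′ ∪ᴳ H)) v b∈))))

    fill-triangulation : IsTriangulation G (G′ ∪ᴳ H)
    fill-triangulation = record
      { sameVertices = V-fill
      ; addsEdges    = inj₁ ∘ inj₁
      ; chordal      = reduces⇒chordal fill-reduces
      }

    fill-clique : ∀ {Q} → IsClique (G′ ∪ᴳ H) Q → Q ⊆ ⁅ v ⁆ ∪ Graph.N[_] G v ⊎ IsClique H Q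
    fill-clique {Q} (Q⊆V , adj) with v ∈? Q
    ... | yes v∈Q = inj₁ Q⊆N
      where
      Q⊆N : Q ⊆ ⁅ v ⁆ ∪ Graph.N[_] G v
      Q⊆N {u} u∈Q with u ≟ᶠ v
      ... | yes refl = p⊆p∪q _ (x∈⁅x⁆ v)
      ... | no  u≢v  = q⊆p∪q ⁅ v ⁆ _ (∈-N⁺ G (fill-neighbour (adj v∈Q u∈Q (u≢v ∘ sym))))
    ... | no  v∉Q = inj₂
      ( (λ u∈Q → ∈-VH⁺ (subst (_ ∈_) V-fill (Q⊆V u∈Q)) (≢v u∈Q))
      , λ a∈Q b∈Q a≢b → fill-rest (≢v a∈Q) (≢v b∈Q) (adj a∈Q b∈Q a≢b))
      where
      ≢v : ∀ {u} → u ∈ Q → u ≢ v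
      ≢v u∈Q refl = v∉Q u∈Q

  remove-triangulation : ∀ {H} → IsTriangulation G H → Simplicial H (V H) v →
                         IsTriangulation filled (H [ ∁ ⁅ v ⁆ ])
  remove-triangulation {H} H-tri simplicial = record
    { sameVertices = cong (_∩ ∁ ⁅ v ⁆) sameVertices
    ; addsEdges    = λ (a~b , a∈ , b∈) → adds a~b , a∈ , b∈
    ; chordal      = IsTriangulation.chordal ([]-triangulation (∁ ⁅ v ⁆) H-tri)
    }
    where
    open IsTriangulation H-tri
    adds : ∀ {a b} → a ~⟨ G′ ⟩ b → a ~⟨ H ⟩ b
    adds (inj₁ a~b)               = addsEdges a~b
    adds (inj₂ (a∈ , b∈ , a≢b)) =
      let a∈V , a∈N = x∈p∩q⁻ (V G) _ a∈
          b∈V , b∈N = x∈p∩q⁻ (V G) _ b∈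
      in simplicial (subst (_ ∈_) (sym sameVertices) a∈V) (subst (_ ∈_) (sym sameVertices) b∈V)
           (addsEdges (∈-N⁻ G a∈N)) (addsEdges (∈-N⁻ G b∈N)) a≢b

  neighbourhood-clique : ∀ {H} → IsTriangulation G H → Simplicial H (V H) v →
                         IsClique H (⁅ v ⁆ ∪ Graph.N[_] G v)
  neighbourhood-clique {H} H-tri simplicial =
    (λ u∈ → subst (_ ∈_) (sym sameVertices) ([ (λ { refl → v∈V }) , ~⇒∈ʳ G ]′ (∈-star u∈))) ,
    λ a∈ b∈ → adjacent (∈-star a∈) (∈-star b∈)
    where
    open IsTriangulation H-tri
    ∈-star : ∀ {u} → u ∈ ⁅ v ⁆ ∪ Graph.N[_] G v → u ≡ v ⊎ v ~⟨ G ⟩ u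
    ∈-star u∈ = Sum.map (x∈⁅y⁆⇒x≡y v) (∈-N⁻ G) (x∈p∪q⁻ ⁅ v ⁆ _ u∈)
    adjacent : ∀ {a b} → a ≡ v ⊎ v ~⟨ G ⟩ a → b ≡ v ⊎ v ~⟨ G ⟩ b → a ≢ b → a ~⟨ H ⟩ b
    adjacent (inj₁ refl) (inj₁ refl) a≢b = ⊥-elim (a≢b refl)
    adjacent (inj₁ refl) (inj₂ v~b)  _   = addsEdges v~b
    adjacent (inj₂ v~a)  (inj₁ refl) _   = Graph.~-sym H (addsEdges v~a)
    adjacent (inj₂ v~a)  (inj₂ v~b)  a≢b = simplicial
      (~⇒∈ʳ H (addsEdges v~a)) (~⇒∈ʳ H (addsEdges v~b)) (addsEdges v~a) (addsEdges v~b) a≢b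

-- `U` is given by the edges it must and may have, so that all parts are treated alike. In the
-- application `n` is 3 and `K` is `W ∪ X`.
module Glue {N n : ℕ} (G : Graph N) (X K : Subset N) (P : Fin n → Subset N) (H : Fin n → Graph N) (U : Graph N)
  (X⊆K          : X ⊆ K)
  (part⊆V       : ∀ i → P i ∪ X ⊆ V G)
  (cover        : ∀ {u} → u ∈ V G → u ∈ X ⊎ ∃[ i ] u ∈ P i)
  (disjoint-X   : ∀ i → Disjoint X (P i))
  (disjoint     : ∀ {i j} → i ≢ j → Disjoint (P i) (P j))
  (separated    : ∀ {i j} → i ≢ j → Separated G (P i) (P j))
  (triangulates : ∀ i → IsTriangulation (G [ P i ∪ X ]) (H i))
  (K-clique     : ∀ i → PairwiseAdjacent (H i) (K ∩ (P i ∪ X)))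
  (V-U          : V U ≡ V G)
  (G⇒U          : ∀ {u v} → u ~⟨ G ⟩ v → u ~⟨ U ⟩ v)
  (H⇒U          : ∀ i {u v} → u ~⟨ H i ⟩ v → u ~⟨ U ⟩ v)
  (K⇒U          : PairwiseAdjacent U K)
  (U⇒           : ∀ {u v} → u ~⟨ U ⟩ v →
                  u ~⟨ G ⟩ v ⊎ (∃[ i ] u ~⟨ H i ⟩ v) ⊎ (u ∈ K × v ∈ K))
  where

  V-H : ∀ i → V (H i) ≡ V G ∩ (P i ∪ X)
  V-H i = IsTriangulation.sameVertices (triangulates i)

  ∈-part : ∀ i {u} → u ∈ V (H i) → u ∈ P i ∪ X
  ∈-part i u∈ = proj₂ (∈-V[]⁻ G (P i ∪ X) (subst (_ ∈_) (V-H i) u∈))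

  part⊆VH : ∀ i {u} → u ∈ P i ∪ X → u ∈ V (H i)
  part⊆VH i u∈ = subst (_ ∈_) (sym (V-H i)) (x∈p∩q⁺ (part⊆V i u∈ , u∈))

  meet : ∀ {i j u} → i ≢ j → u ∈ P i ∪ X → u ∈ P j ∪ X → u ∈ X
  meet {i} {j} i≢j u∈i u∈j with x∈p∪q⁻ (P i) X u∈i | x∈p∪q⁻ (P j) X u∈j
  ... | inj₂ u∈X | _        = u∈X
  ... | inj₁ _   | inj₂ u∈X = u∈X
  ... | inj₁ u∈i | inj₁ u∈j = ⊥-elim (disjoint⁻ (disjoint i≢j) u∈i u∈j)

  -- Two parts meet in X only, and K ∩ (P i ∪ X) is a clique of H i already.
  U⇒H : ∀ i {u v} → u ∈ P i ∪ X → v ∈ P i ∪ X → u ~⟨ U ⟩ v → u ~⟨ H i ⟩ v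
  U⇒H i {u} {v} u∈ v∈ u~v with U⇒ u~v
  ... | inj₁ u~v = IsTriangulation.addsEdges (triangulates i) (u~v , u∈ , v∈)
  ... | inj₂ (inj₂ (u∈K , v∈K)) =
    K-clique i (x∈p∩q⁺ (u∈K , u∈)) (x∈p∩q⁺ (v∈K , v∈)) (~⇒≢ U u~v)
  ... | inj₂ (inj₁ (j , u~v′)) with i ≟ᶠ j
  ...   | yes refl = u~v′
  ...   | no  i≢j  = K-clique i
    (x∈p∩q⁺ (X⊆K (meet i≢j u∈ (∈-part j (Graph.~⇒∈ (H j) u~v′))) , u∈))
    (x∈p∩q⁺ (X⊆K (meet i≢j v∈ (∈-part j (~⇒∈ʳ (H j) u~v′))) , v∈))
    (~⇒≢ U u~v)

  -- None of the three kinds of edges leaves the part at `a`: clique edges start in `K`, edges of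
  -- another part's triangulation would start in `X ⊆ K`, and edges of `G` do not cross between
  -- parts.
  closed : ∀ i {a u} → a ∈ P i ∪ X → a ∉ K → a ~⟨ U ⟩ u → u ∈ P i ∪ X
  closed i {a} {u} a∈ a∉K a~u with U⇒ a~u
  ... | inj₂ (inj₂ (a∈K , _)) = ⊥-elim (a∉K a∈K)
  ... | inj₂ (inj₁ (j , a~u′)) with i ≟ᶠ j
  ...   | yes refl = ∈-part i (~⇒∈ʳ (H i) a~u′)
  ...   | no  i≢j  = ⊥-elim (a∉K (X⊆K (meet i≢j a∈ (∈-part j (Graph.~⇒∈ (H j) a~u′)))))
  closed i {a} {u} a∈ a∉K a~u | inj₁ a~u′ with x∈p∪q⁻ (P i) X a∈ | cover (~⇒∈ʳ G a~u′)
  ... | inj₂ a∈X | _        = ⊥-elim (a∉K (X⊆K a∈X))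
  ... | inj₁ _   | inj₁ u∈X = q⊆p∪q (P i) X u∈X
  ... | inj₁ a∈i | inj₂ (j , u∈j) with i ≟ᶠ j
  ...   | yes refl = p⊆p∪q X u∈j
  ...   | no  i≢j  = ⊥-elim (separated i≢j a∈i u∈j a~u′)

  -- Each part in turn loses exactly its vertices outside `K`. The later parts stay intact because
  -- parts share only `X ⊆ K`, and what is left at the end lies in the clique `K`.
  parts-reduce : ∀ is {S} → Unique is → All (λ i → P i ∪ X ⊆ S) is →
                 (∀ {u} → u ∈ S → u ∈ K ⊎ Any (λ i → u ∈ P i) is) → Reduces U ⊥ S
  parts-reduce [] _ _ S⊆ = clique-reduces U (<-wellFounded _) λ a∈S b∈S →
    K⇒U (∈K (S⊆ a∈S)) (∈K (S⊆ b∈S))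
    where
    ∈K : ∀ {u} → u ∈ K ⊎ Any (λ i → u ∈ P i) [] → u ∈ K
    ∈K (inj₁ u∈K) = u∈K
  parts-reduce (i ∷ is) {S} (i≢ ∷ unique) (Pᵢ⊆S ∷ P⊆S) S⊆ = reduces-part
    {T = P i ∪ X} {R = S ─ (P i ─ K)}
    (chordal⇒reduces (H i) (IsTriangulation.chordal (triangulates i)) (<-wellFounded _)
      (p∩q⊆q K (P i ∪ X)) (K-clique i))
    Pᵢ⊆S
    (λ a∈ a∉ _ a~u → closed i a∈ (λ a∈K → a∉ (x∈p∩q⁺ (a∈K , a∈))) a~u)
    (H⇒U i) (U⇒H i)
    (λ u∈S T⇒K → x∈p∧x∉q⇒x∈p─q u∈S λ u∈ → x∈p─q⇒x∉q (P i) K u∈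
      (proj₁ (x∈p∩q⁻ K _ (T⇒K (p⊆p∪q X (p─q⊆p (P i) K u∈))))))
    (parts-reduce is unique (remaining i≢ P⊆S) rest)
    where
    avoids : ∀ {j} → i ≢ j → P j ∪ X ⊆ S → P j ∪ X ⊆ S ─ (P i ─ K)
    avoids {j} i≢j Pⱼ⊆S u∈ = x∈p∧x∉q⇒x∈p─q (Pⱼ⊆S u∈) λ u∈i →
      [ (λ u∈j → disjoint⁻ (disjoint i≢j) (p─q⊆p (P i) K u∈i) u∈j)
      , (λ u∈X → x∈p─q⇒x∉q (P i) K u∈i (X⊆K u∈X)) ]′ (x∈p∪q⁻ (P j) X u∈)
    remaining : ∀ {js} → All (i ≢_) js → All (λ j → P j ∪ X ⊆ S) js →
                All (λ j → P j ∪ X ⊆ S ─ (P i ─ K)) js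
    remaining []         []         = []
    remaining (i≢j ∷ i≢) (P⊆ ∷ Ps⊆) = avoids i≢j P⊆ ∷ remaining i≢ Ps⊆
    rest : ∀ {u} → u ∈ S ─ (P i ─ K) → u ∈ K ⊎ Any (λ i → u ∈ P i) is
    rest {u} u∈ with S⊆ (p─q⊆p S _ u∈)
    ... | inj₁ u∈K         = inj₁ u∈K
    ... | inj₂ (there u∈P) = inj₂ u∈P
    ... | inj₂ (here u∈P) with u ∈? K
    ...   | yes u∈K = inj₁ u∈K
    ...   | no  u∉K = ⊥-elim (x∈p─q⇒x∉q S _ u∈ (x∈p∧x∉q⇒x∈p─q u∈P u∉K))

  glue-triangulation : IsTriangulation G U
  glue-triangulation = record
    { sameVertices = V-U
    ; addsEdges    = G⇒U
    ; chordal      = reduces⇒chordal (subst (Reduces U ⊥) (sym V-U)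
        (parts-reduce (allFin n) (allFin⁺ n) (All.tabulate λ {i} _ → part⊆V i)
          (λ u∈V → Sum.map X⊆K (λ (i , u∈) → lose (∈-allFin i) u∈) (cover u∈V))))
    }

  -- A single vertex of `Q` outside `K` confines all of `Q` to its part, by `closed`.
  glue-clique : ∀ {Q} → IsClique U Q → Q ⊆ K ⊎ ∃[ i ] IsClique (H i) Q
  glue-clique {Q} (Q⊆V , adj) with any? (λ q → (q ∈? Q) ×-dec ¬? (q ∈? K))
  ... | no  Q⊆K = inj₁ λ {q} q∈Q → decidable-stable (q ∈? K) λ q∉K → Q⊆K (q , q∈Q , q∉K)
  ... | yes (q , q∈Q , q∉K) with cover (subst (_ ∈_) V-U (Q⊆V q∈Q))
  ...   | inj₁ q∈X       = ⊥-elim (q∉K (X⊆K q∈X))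
  ...   | inj₂ (i , q∈P) = inj₂ (i , part⊆VH i ∘ Q⊆P , λ a∈Q b∈Q a≢b →
    U⇒H i (Q⊆P a∈Q) (Q⊆P b∈Q) (adj a∈Q b∈Q a≢b))
    where
    Q⊆P : Q ⊆ P i ∪ X
    Q⊆P {u} u∈Q with q ≟ᶠ u
    ... | yes refl = p⊆p∪q X q∈P
    ... | no  q≢u  = closed i (p⊆p∪q X q∈P) q∉K (adj q∈Q u∈Q q≢u)

-- Weights and optimal triangulations

isClique? : ∀ (H : Graph N) S → Dec (IsClique H S)
isClique? H S = (S ⊆? V H) ×-dec map′ (λ f {u} {v} → f u v) (λ f u v → f {u} {v})
  (all? λ u → all? λ v → (u ∈? S) →-dec (v ∈? S) →-dec ¬? (u ≟ᶠ v) →-dec Graph._~?_ H u v)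

empty-triangulation : ∀ {G : Graph N} → Empty (V G) → IsTriangulation G G
empty-triangulation {G = G} V≡∅ = record
  { sameVertices = refl
  ; addsEdges    = id
  ; chordal      = λ _ c → ⊥-elim (V≡∅ (_ , Graph.~⇒∈ G (Cycle.adjacent c zero)))
  }

triangulation-clique : ∀ {G H : Graph N} {Q} → IsTriangulation G H → IsClique G Q → IsClique H Q
triangulation-clique tri (Q⊆V , adj) =
  (λ u∈Q → subst (_ ∈_) (sym sameVertices) (Q⊆V u∈Q)) ,
  λ u∈Q v∈Q u≢v → addsEdges (adj u∈Q v∈Q u≢v)
  where open IsTriangulation tri

∣V∩∁⁅⁆∣< : ∀ (G : Graph N) {v} → v ∈ V G → ∣ V (G [ ∁ ⁅ v ⁆ ]) ∣ ℕ.< ∣ V G ∣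
∣V∩∁⁅⁆∣< G {v} v∈V = p⊂q⇒∣p∣<∣q∣
  (p∩q⊆p _ _ , v , v∈V , λ v∈ → x∈∁p⇒x∉p (proj₂ (x∈p∩q⁻ (V G) _ v∈)) (x∈⁅x⁆ v))

module _ (R : CompleteOrderedField) where
  open CompleteOrderedField R

  open CommutativeSum (CommutativeRing.+-commutativeMonoid commutativeRing) using (∑-distrib-+)

  sum-mono-≤ : ∀ {n} {f g : Fin n → ℝ} → (∀ i → f i ≤ g i) → sum f ≤ sum g
  sum-mono-≤ {zero}  _   = ≤-refl
  sum-mono-≤ {suc n} f≤g = +-mono-≤ (f≤g zero) (sum-mono-≤ (f≤g ∘ suc))

  maximum : ∀ {n} {P : Subset n → Set} → (∀ S → Dec (P S)) → (f : Subset n → ℝ) → ∃ P →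
            ∃[ S ] (P S × (∀ {T} → P T → f T ≤ f S))
  maximum {zero} P? f ([] , p) = [] , p , λ { {[]} _ → ≤-refl }
  maximum {suc n} {P} P? f (S₀ , p₀) with anySubset? (P? ∘ (inside ∷_)) | anySubset? (P? ∘ (outside ∷_))
  ... | yes in≢∅ | no out≡∅ =
    let S , p , S-max = maximum (P? ∘ (inside ∷_)) (f ∘ (inside ∷_)) in≢∅
    in inside ∷ S , p , λ { {inside ∷ T} q → S-max q ; {outside ∷ T} q → ⊥-elim (out≡∅ (T , q)) }
  ... | no in≡∅ | yes out≢∅ =
    let S , p , S-max = maximum (P? ∘ (outside ∷_)) (f ∘ (outside ∷_)) out≢∅
    in outside ∷ S , p , λ { {inside ∷ T} q → ⊥-elim (in≡∅ (T , q)) ; {outside ∷ T} q → S-max q }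
  maximum {suc n} P? f (inside  ∷ S₀ , p₀) | no in≡∅ | no _ = ⊥-elim (in≡∅ (S₀ , p₀))
  maximum {suc n} P? f (outside ∷ S₀ , p₀) | no _ | no out≡∅ = ⊥-elim (out≡∅ (S₀ , p₀))
  maximum {suc n} P? f _ | yes in≢∅ | yes out≢∅
    with maximum (P? ∘ (inside ∷_)) (f ∘ (inside ∷_)) in≢∅ | maximum (P? ∘ (outside ∷_)) (f ∘ (outside ∷_)) out≢∅
  ... | S , p , S-max | T , q , T-max with ≤-total (f (inside ∷ S)) (f (outside ∷ T))
  ...   | inj₁ S≤T = outside ∷ T , q , λ { {inside ∷ _} r → ≤-trans (S-max r) S≤T ; {outside ∷ _} r → T-max r }
  ...   | inj₂ T≤S = inside ∷ S , p , λ { {inside ∷ _} r → S-max r ; {outside ∷ _} r → ≤-trans (T-max r) T≤S }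

  module NonnegativeWeights {N : ℕ} (w : Fin N → ℝ) (0≤w : ∀ v → 0# ≤ w v) where
    open Weighted R w

    restricted : Subset N → Fin N → ℝ
    restricted S v = if does (v ∈? S) then w v else 0#

    weight-mono : ∀ {S T} → S ⊆ T → weight S ≤ weight T
    weight-mono {S} {T} S⊆T = sum-mono-≤ pointwise
      where
      pointwise : ∀ v → restricted S v ≤ restricted T v
      pointwise v with v ∈? S | v ∈? T
      ... | yes _   | yes _   = ≤-refl
      ... | yes v∈S | no  v∉T = ⊥-elim (v∉T (S⊆T v∈S))
      ... | no  _   | yes _   = 0≤w v
      ... | no  _   | no  _   = ≤-refl

    weight-∪ : ∀ S T → weight (S ∪ T) ≤ weight S + weight T
    weight-∪ S T = ≤-respʳ-≈ (∑-distrib-+ (restricted S) (restricted T)) (sum-mono-≤ pointwise)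
      where
      pointwise : ∀ v → restricted (S ∪ T) v ≤
                        restricted S v + restricted T v
      pointwise v with v ∈? S ∪ T | v ∈? S | v ∈? T
      ... | no  _ | no  _   | no _    = ≤-reflexive (≈-sym (+-identityʳ 0#))
      ... | no  _ | no  _   | yes _   = ≤-respʳ-≈ (≈-sym (+-identityˡ _)) (0≤w v)
      ... | no  _ | yes _   | no _    = ≤-respʳ-≈ (≈-sym (+-identityʳ _)) (0≤w v)
      ... | no  _ | yes _   | yes _   = ≤-respˡ-≈ (+-identityʳ 0#) (+-mono-≤ (0≤w v) (0≤w v))
      ... | yes _ | yes _   | yes _   = ≤-respˡ-≈ (+-identityʳ _) (+-mono-≤ ≤-refl (0≤w v))
      ... | yes _ | yes _   | no _    = ≤-reflexive (≈-sym (+-identityʳ _))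
      ... | yes _ | no _    | yes _   = ≤-reflexive (≈-sym (+-identityˡ _))
      ... | yes v∈ | no v∉S | no v∉T  = ⊥-elim (∉-∪ v∉S v∉T v∈)

    weight-disjoint : ∀ {S T} → Disjoint S T → weight S + weight T ≤ weight (S ∪ T)
    weight-disjoint {S} {T} S∩T = ≤-respˡ-≈ (∑-distrib-+ (restricted S) (restricted T)) (sum-mono-≤ pointwise)
      where
      pointwise : ∀ v → restricted S v + restricted T v ≤
                        restricted (S ∪ T) v
      pointwise v with v ∈? S ∪ T | v ∈? S | v ∈? T
      ... | _      | yes v∈S | yes v∈T = ⊥-elim (disjoint⁻ S∩T v∈S v∈T)
      ... | yes _  | yes _   | no _    = ≤-reflexive (+-identityʳ _)
      ... | yes _  | no _    | yes _   = ≤-reflexive (+-identityˡ _)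
      ... | yes _  | no _    | no _    = ≤-respˡ-≈ (≈-sym (+-identityˡ 0#)) (0≤w v)
      ... | no v∉  | yes v∈S | _       = ⊥-elim (v∉ (x∈p∪q⁺ (inj₁ v∈S)))
      ... | no v∉  | no _    | yes v∈T = ⊥-elim (v∉ (x∈p∪q⁺ (inj₂ v∈T)))
      ... | no _   | no _    | no _    = ≤-reflexive (+-identityˡ 0#)

    0≤weight : ∀ S → 0# ≤ weight S
    -- From w(S) ≤ w(S ∪ S) ≤ w(S) + w(S).
    0≤weight S = +-cancelˡ-≤ (weight S) (≤-respˡ-≈ (≈-sym (+-identityʳ _))
      (≤-trans (weight-mono (p⊆p∪q S)) (weight-∪ S S)))

    CliquesBelow : Graph N → ℝ → Set
    CliquesBelow H b = ∀ {Q} → IsClique H Q → weight Q ≤ b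

    heaviest-bound : ∀ H {c} → IsHeaviestCliqueWeight H c → CliquesBelow H c
    heaviest-bound _ (_ , c-max) Q-clique = c-max (_ , Q-clique , ≈-refl)

    heaviestClique : ∀ H → ∃ (IsHeaviestCliqueWeight H)
    heaviestClique H =
      let S , S-clique , S-max = maximum (isClique? H) weight
            (⊥ , (λ u∈⊥ → ⊥-elim (∉⊥ u∈⊥)) , λ u∈⊥ → ⊥-elim (∉⊥ u∈⊥))
      in weight S , (S , S-clique , ≈-refl) , λ (_ , T-clique , T≈y) → ≤-respˡ-≈ T≈y (S-max T-clique)

    -- `H` itself need not satisfy `Restriction`, which only limits its competitors. Hence the
    -- better of two optima is an optimum for the union of their classes.
    record Optimum (G : Graph N) (Restriction : Graph N → Set) : Set₁ where
      field
        H             : Graph N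
        c             : ℝ
        triangulation : IsTriangulation G H
        heaviest      : IsHeaviestCliqueWeight H c
        least         : ∀ {H′ b} → IsTriangulation G H′ → Restriction H′ → CliquesBelow H′ b → c ≤ b

    optimum-⊎ : ∀ {G P Q} → Optimum G P → Optimum G Q → Optimum G (λ H → P H ⊎ Q H)
    optimum-⊎ o p with ≤-total (Optimum.c o) (Optimum.c p)
    ... | inj₁ o≤p = record
      { H = H ; c = c ; triangulation = triangulation ; heaviest = heaviest
      ; least = λ { tri (inj₁ r) below → least tri r below
                  ; tri (inj₂ r) below → ≤-trans o≤p (Optimum.least p tri r below) } }
      where open Optimum o
    ... | inj₂ p≤o = record
      { H = H ; c = c ; triangulation = triangulation ; heaviest = heaviest
      ; least = λ { tri (inj₁ r) below → ≤-trans p≤o (Optimum.least o tri r below)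
                  ; tri (inj₂ r) below → least tri r below } }
      where open Optimum p

    optimum-weaken : ∀ {G P Q} → (∀ {H} → IsTriangulation G H → Q H → P H) → Optimum G P → Optimum G Q
    optimum-weaken Q⇒P o = record
      { H = H ; c = c ; triangulation = triangulation ; heaviest = heaviest
      ; least = λ tri r → least tri (Q⇒P tri r) }
      where open Optimum o

    Unrestricted : Graph N → Set
    Unrestricted _ = Unit

    SimplicialIn : Fin N → Graph N → Set
    SimplicialIn v H = Simplicial H (V H) v

    -- A triangulation in which v is simplicial contains all edges that the
    -- elimination of v fills in.
    fill-optimum : ∀ {G v} (v∈V : v ∈ V G) → Optimum (Fill.filled G v∈V) Unrestricted →
                   Optimum G (SimplicialIn v)
    fill-optimum {G} {v} v∈V o =
      let c , heaviest = heaviestClique (G′ ∪ᴳ H) in record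
        { H             = G′ ∪ᴳ H
        ; c             = c
        ; triangulation = fill-triangulation triangulation
        ; heaviest      = heaviest
        ; least         = λ tri simplicial below →
            let (_ , Q-clique , Q≈c) , _ = heaviest in
            ≤-respˡ-≈ Q≈c (bound tri simplicial below (fill-clique triangulation Q-clique))
        }
      where
      open Optimum o hiding (c; heaviest)
      open Fill G v∈V
      bound : ∀ {H′ b Q} → IsTriangulation G H′ → SimplicialIn v H′ → CliquesBelow H′ b →
              Q ⊆ ⁅ v ⁆ ∪ Graph.N[_] G v ⊎ IsClique H Q → weight Q ≤ b
      bound tri simplicial below (inj₁ Q⊆N) =
        ≤-trans (weight-mono Q⊆N) (below (neighbourhood-clique tri simplicial))
      bound {H′} tri simplicial below (inj₂ Q-clique) =
        ≤-trans (heaviest-bound H (Optimum.heaviest o) Q-clique)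
          (least (remove-triangulation tri simplicial) tt
            λ Q-clique → below ([]-clique {H = H′} {S = ∁ ⁅ v ⁆} Q-clique))

    -- Triangulations of a non-empty graph fall into finitely many classes according to a simplicial
    -- vertex, which exists by Dirac's theorem. Each class reduces to the smaller graph obtained by
    -- eliminating that vertex.
    optimum : ∀ G → Acc ℕ._<_ ∣ V G ∣ → Optimum G Unrestricted
    optimum G (acc rs) with nonempty? (V G)
    ... | no V≡∅ = let c , heaviest = heaviestClique G in record
      { H = G ; c = c ; triangulation = empty-triangulation V≡∅ ; heaviest = heaviest
      ; least = λ tri _ below → let (_ , Q-clique , Q≈c) , _ = heaviest in
          ≤-respˡ-≈ Q≈c (below (triangulation-clique tri Q-clique)) }
    -- Putting `v₀` in front of the list of all vertices makes the list visibly non-empty, as `best`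
    -- requires.
    ... | yes (v₀ , v₀∈V) = optimum-weaken some-simplicial
      (best v₀∈V (All.tabulate (proj₂ ∘ ∈-filter⁻ (_∈? V G) {xs = allFin N})))
      where
      SomeSimplicial : List (Fin N) → Graph N → Set
      SomeSimplicial vs H = Any (λ v → SimplicialIn v H) vs
      best : ∀ {v vs} → v ∈ V G → All (_∈ V G) vs → Optimum G (SomeSimplicial (v ∷ vs))
      best {v} v∈V [] = optimum-weaken {P = SimplicialIn v} (λ { _ (here s) → s })
        (fill-optimum v∈V (optimum _ (rs (∣V∩∁⁅⁆∣< G v∈V))))
      best {v} {us} v∈V (u∈V ∷ vs⊆V) = optimum-weaken
        {P = λ H → SimplicialIn v H ⊎ SomeSimplicial us H}
        (λ { _ (here s) → inj₁ s ; _ (there s) → inj₂ s })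
        (optimum-⊎ {P = SimplicialIn v}
          (fill-optimum v∈V (optimum _ (rs (∣V∩∁⁅⁆∣< G v∈V)))) (best u∈V vs⊆V))
      some-simplicial : ∀ {H} → IsTriangulation G H → Unrestricted H →
                        SomeSimplicial (v₀ ∷ filter (_∈? V G) (allFin N)) H
      some-simplicial {H} tri _ =
        let v , v∈V , _ , simplicial = simplicial-outside H chordal (V H) ⊥ (<-wellFounded _) ⊥⊆
              (λ u∈⊥ → ⊥-elim (∉⊥ u∈⊥)) (subst (v₀ ∈_) (sym sameVertices) v₀∈V) ∉⊥
        in there (lose (∈-filter⁺ (_∈? V G) (∈-allFin v) (subst (v ∈_) sameVertices v∈V)) simplicial)
        where open IsTriangulation tri

    optimum⇒cliquewidth : ∀ {G} (o : Optimum G Unrestricted) → IsWeightedCliquewidth G (Optimum.c o)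
    optimum⇒cliquewidth o = (H , triangulation , heaviest) ,
      λ (H′ , tri , heaviest′) → least tri tt (heaviest-bound H′ heaviest′)
      where open Optimum o

-- Correctness of the algorithm

module Correctness (R : CompleteOrderedField) {N : ℕ} (w : Fin N → CompleteOrderedField.ℝ R) 
  (0≤w : ∀ v → CompleteOrderedField._≤_ R (CompleteOrderedField.0# R) (w v))
  (m α : CompleteOrderedField.ℝ R)
  (1≤α : CompleteOrderedField._≤_ R (CompleteOrderedField.1# R) α) where
  open CompleteOrderedField R
  open Weighted R w
  open NonnegativeWeights R w 0≤w
  open CommutativeRing commutativeRing using (distribˡ; distribʳ; zeroʳ)

  <⇒≱ : ∀ {x y} → x < y → ¬ (y ≤ x)
  <⇒≱ (x≤y , x≉y) y≤x = x≉y (≤-antisym x≤y y≤x)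

  ≰⇒> : ∀ {x y} → ¬ (y ≤ x) → x < y
  ≰⇒> {x} {y} y≰x = [ id , (λ y≤x → ⊥-elim (y≰x y≤x)) ]′ (≤-total x y) , λ x≈y → y≰x (≤-reflexive (≈-sym x≈y))

  ≤-<-trans : ∀ {x y z} → x ≤ y → y < z → x < z
  ≤-<-trans x≤y y<z = ≰⇒> λ z≤x → <⇒≱ y<z (≤-trans z≤x x≤y)

  +-cancelʳ-≤ : ∀ x {y z} → y + x ≤ z + x → y ≤ z
  +-cancelʳ-≤ x h = +-cancelˡ-≤ x (≤-respˡ-≈ (+-comm _ _) (≤-respʳ-≈ (+-comm _ _) h))

  am M T : ℝ
  am = α * m
  M  = (α + 1#) * m
  T  = (2# * α + 1#) * m

  M≈ : M ≈ am + m
  M≈ = ≈-trans (distribʳ m α 1#) (+-congˡ (*-identityˡ m))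

  T≈ : T ≈ am + M
  T≈ = ≈-trans (*-cong (≈-trans (+-congʳ (≈-trans (distribʳ α 1# 1#) (+-cong (*-identityˡ α) (*-identityˡ α))))
      (+-assoc α α 1#)) ≈-refl) (distribʳ m α (α + 1#))

  -- The premise holds because a set of non-negative weight lies below `M`; as α + 1 is
  -- non-negative, it forces m to be positive.
  module _ (M≰0 : ¬ (M ≤ 0#)) where

    0≤α+1 : 0# ≤ α + 1#
    0≤α+1 = ≤-respˡ-≈ (+-identityʳ 0#) (+-mono-≤ (≤-trans 0≤1 1≤α) 0≤1)

    m≰0 : ¬ (m ≤ 0#)
    m≰0 m≤0 = M≰0 (+-cancelʳ-≤ ((α + 1#) * - m)
      (≤-respˡ-≈ (≈-sym M-M) (≤-respʳ-≈ (≈-sym (+-identityˡ _)) (*-nonneg 0≤α+1 0≤-m))))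
      where
      0≤-m : 0# ≤ - m
      0≤-m = ≤-respˡ-≈ (-‿inverseˡ m) (≤-respʳ-≈ (+-identityʳ _) (+-monoʳ-≤ (- m) m≤0))
      M-M : M + (α + 1#) * - m ≈ 0#
      M-M = ≈-trans (≈-sym (distribˡ (α + 1#) m (- m)))
        (≈-trans (*-cong ≈-refl (-‿inverseʳ m)) (zeroʳ _))

    0≤m : 0# ≤ m
    0≤m = proj₁ (≰⇒> m≰0)

    m≤am : m ≤ am
    m≤am = ≤-respˡ-≈ (+-identityˡ m) (≤-respʳ-≈ am≈ (+-mono-≤ (*-nonneg 0≤α-1 0≤m) ≤-refl))
      where
      0≤α-1 : 0# ≤ α + - 1#
      0≤α-1 = ≤-respˡ-≈ (-‿inverseʳ 1#) (+-mono-≤ 1≤α ≤-refl)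
      am≈ : (α + - 1#) * m + m ≈ am
      am≈ = ≈-trans (+-congˡ (≈-sym (*-identityˡ m)))
        (≈-trans (≈-sym (distribʳ m (α + - 1#) 1#))
          (*-cong (≈-trans (+-assoc _ _ _) (≈-trans (+-congˡ (-‿inverseˡ 1#)) (+-identityʳ α))) ≈-refl))

    am≰0 : ¬ (am ≤ 0#)
    am≰0 am≤0 = m≰0 (≤-trans m≤am am≤0)

    m<M : m < M
    m<M = ≰⇒> λ M≤m → am≰0 (+-cancelʳ-≤ m
      (≤-respˡ-≈ M≈ (≤-respʳ-≈ (≈-sym (+-identityˡ m)) M≤m)))

    -- Used to exclude that all vertices of a heavy graph form one clique of weight at most m.
    T≰m : ¬ (T ≤ m)
    T≰m T≤m = <⇒≱ m<M (≤-trans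
      (≤-respˡ-≈ (+-identityˡ M) (≤-respʳ-≈ (≈-sym T≈) (+-mono-≤ (≤-trans 0≤m m≤am) ≤-refl))) T≤m)

    -- If M ≤ s + x, then 2M ≤ t + 2m ≤ t + M.
    half-light : ∀ {s x t} → s + s ≤ t → t < M → x ≤ m → s + x < M
    half-light {s} {x} {t} 2s≤t t<M x≤m = ≰⇒> λ M≤s+x → <⇒≱ t<M (+-cancelʳ-≤ M
      (≤-trans (+-mono-≤ M≤s+x M≤s+x) (≤-respˡ-≈ (≈-sym interchange)
        (+-mono-≤ 2s≤t (≤-trans (+-mono-≤ x≤m x≤m) (≤-respʳ-≈ (≈-sym M≈) (+-mono-≤ m≤am ≤-refl)))))))
      where
      interchange : (s + x) + (s + x) ≈ (s + s) + (x + x)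
      interchange = ≈-trans (+-assoc s x (s + x)) (≈-trans
        (+-congˡ (≈-trans (≈-sym (+-assoc x s x)) (≈-trans (+-congʳ (+-comm x s)) (+-assoc s x x))))
        (≈-sym (+-assoc s s (x + x))))

  -- The origin of 2α+1: the clique `W ∪ X` weighs less than (α+1)m + αm.
  light-∪ : ∀ {t x} → t < M → x ≤ am → t + x < T
  light-∪ {t} {x} t<M x≤am = ≰⇒> λ T≤t+x → <⇒≱ t<M (+-cancelˡ-≤ am
    (≤-trans (≤-respˡ-≈ T≈ T≤t+x) (≤-respʳ-≈ (+-comm t am) (+-monoʳ-≤ t x≤am))))

  weight<M⇒M≰0 : ∀ {W} → weight W < M → ¬ (M ≤ 0#)
  weight<M⇒M≰0 {W} W<M M≤0 = <⇒≱ W<M (≤-trans M≤0 (0≤weight W))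

  -- Cliquewidth at most m, phrased without the minimum.
  Narrow : Graph N → Set₁
  Narrow G = ∃[ H ] (IsTriangulation G H × CliquesBelow H m)

  module _ (W : Subset N) where

    -- Doubling one side avoids a division.
    Half : Subset N → Set
    Half S = weight (W ∩ S) + weight (W ∩ S) ≤ weight W

    ∩-mono : ∀ {S T} → S ⊆ T → W ∩ S ⊆ W ∩ T
    ∩-mono {S} S⊆T u∈ = let u∈W , u∈S = x∈p∩q⁻ W S u∈ in x∈p∩q⁺ (u∈W , S⊆T u∈S)

    half-mono : ∀ {S T} → S ⊆ T → Half T → Half S
    half-mono S⊆T = ≤-trans (+-mono-≤ (weight-mono (∩-mono S⊆T)) (weight-mono (∩-mono S⊆T)))

    half-⊎ : ∀ {S T} → Disjoint S T → Half S ⊎ Half T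
    half-⊎ {S} {T} S∩T = Sum.map
      (λ s≤t → ≤-trans (+-monoʳ-≤ _ s≤t) S+T≤W)
      (λ t≤s → ≤-trans (+-mono-≤ t≤s ≤-refl) S+T≤W)
      (≤-total (weight (W ∩ S)) (weight (W ∩ T)))
      where
      S+T≤W : weight (W ∩ S) + weight (W ∩ T) ≤ weight W
      S+T≤W = ≤-trans
        (weight-disjoint (disjoint⁺ λ u∈ u∈′ →
          disjoint⁻ S∩T (proj₂ (x∈p∩q⁻ W S u∈)) (proj₂ (x∈p∩q⁻ W T u∈′))))
        (weight-mono (∪-⊆ (p∩q⊆p W S) (p∩q⊆p W T)))

  narrow⇒wDecomposition : ∀ {G W} → T ≤ weight (V G) → weight W < M → Narrow G →
                          HasWDecomposition m α G W
  narrow⇒wDecomposition {G} {W} T≤V W<M (H , H-tri , below) =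
    X , A , B , C , record
      { isDecomposition = record
        { disjoint  = disjoint
        ; covers    = trans covers sameVertices
        ; A≢∅       = A≢∅
        ; B≢∅       = B≢∅
        ; separated = G-separated separated
        }
      ; V-heavy = T≤V
      ; W-light = W<M
      ; X-light = ≤-trans (below X-clique) (m≤am M≰0)
      ; A-light = light A-light
      ; B-light = light B-light
      ; C-light = light C-light
      }
    where
    open IsTriangulation H-tri
    M≰0 : ¬ (M ≤ 0#)
    M≰0 = weight<M⇒M≰0 {W} W<M
    V-not-clique : ¬ IsClique H (V H)
    V-not-clique V-clique = T≰m M≰0 (≤-trans T≤V
      (subst (λ S → weight S ≤ m) sameVertices (below V-clique)))
    open BalancedSeparator (balancedSeparator H (Half W) (λ _ → _ ≤? _) (half-mono W) (half-⊎ W)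
      V-not-clique (triangulation-reduces H-tri))
    open IsDecomposition isDecomposition
    G-separated : ∀ {A B C} → AllPairs (Separated H) (A ∷ B ∷ C ∷ []) → AllPairs (Separated G) (A ∷ B ∷ C ∷ [])
    G-separated ((AB ∷ AC ∷ []) ∷ (BC ∷ []) ∷ [] ∷ []) =
      ((λ u∈ v∈ u~v → AB u∈ v∈ (addsEdges u~v)) ∷ (λ u∈ v∈ u~v → AC u∈ v∈ (addsEdges u~v)) ∷ [])
        ∷ ((λ u∈ v∈ u~v → BC u∈ v∈ (addsEdges u~v)) ∷ []) ∷ [] ∷ []
    light : ∀ {S} → Light H (Half W) (λ _ → _ ≤? _) (half-mono W) (half-⊎ W) X S → weight (W ∩ S ∪ X) < M
    light {S} (inj₁ half) = ≤-<-trans (weight-∪ (W ∩ S) X) (half-light M≰0 half W<M (below X-clique))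
    light {S} (inj₂ clique) = ≤-<-trans
      (≤-trans (weight-mono (∪-mono (p∩q⊆q W S) id)) (below clique)) (m<M M≰0)

  -- By contraposition, the negative answer of a recursive call is correct for `G` as well.
  []-narrow : ∀ {G} S → Narrow G → Narrow (G [ S ])
  []-narrow S (H , tri , below) = H [ S ] , []-triangulation S tri ,
    λ Q-clique → below ([]-clique {H = H} {S = S} Q-clique)

  module _ (choices : Choices m α) where

    fillAcc-triangulation : ∀ G (a : Acc ℕ._<_ ∣ V G ∣) → IsTriangulation G (fillAcc m α choices G a)
    fillAcc-triangulation G (acc rs) with nonempty? (V G)
    ... | no  V≡∅ = empty-triangulation V≡∅
    ... | yes V≢∅ = Fill.fill-triangulation G (proj₁ (proj₂ (Choices.chooseVertex choices G V≢∅)))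
      (fillAcc-triangulation _ (rs _))

    -- The form of correctness that is proved by induction: a bound on every clique in place of a
    -- heaviest one, and `¬ Narrow` in place of the cliquewidth.
    IsCorrect : Graph N → Subset N → Outcome N → Set₁
    IsCorrect G W o =
      (∃[ H ] (o ≡ triangulated H × IsTriangulation G H × IsClique H W
        × (∀ {Q} → IsClique H Q → weight Q < T)))
      ⊎ (o ≡ cliquewidth>m × ¬ Narrow G)

    combine-correct : ∀ {G W X A B C} → W ⊆ V G → IsWDecomposition m α G W X A B C → ∀ {o₁ o₂ o₃} →
                      IsCorrect (G [ A ∪ X ]) (W ∩ A ∪ X) o₁ →
                      IsCorrect (G [ B ∪ X ]) (W ∩ B ∪ X) o₂ →
                      IsCorrect (G [ C ∪ X ]) (W ∩ C ∪ X) o₃ →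
                      IsCorrect G W (combine m α choices G (W ∪ X) o₁ o₂ o₃)
    combine-correct _ _ (inj₂ (refl , wide)) _ _ = inj₂ (refl , wide ∘ []-narrow _)
    combine-correct _ _ (inj₁ (_ , refl , _)) (inj₂ (refl , wide)) _ = inj₂ (refl , wide ∘ []-narrow _)
    combine-correct _ _ (inj₁ (_ , refl , _)) (inj₁ (_ , refl , _)) (inj₂ (refl , wide)) =
      inj₂ (refl , wide ∘ []-narrow _)
    combine-correct {G} {W} {X} {A} {B} {C} W⊆V d
      (inj₁ (H₁ , refl , tri₁ , clique₁ , light₁))
      (inj₁ (H₂ , refl , tri₂ , clique₂ , light₂))
      (inj₁ (H₃ , refl , tri₃ , clique₃ , light₃)) =
      inj₁ (U , refl , glue-triangulation
        , ((λ u∈W → K⊆VU (p⊆p∪q X u∈W)) , λ u∈W v∈W → K⇒U (p⊆p∪q X u∈W) (p⊆p∪q X v∈W))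
        , light ∘ glue-clique)
      where
      open IsWDecomposition d using (isDecomposition; W-light; X-light)
      open IsDecomposition isDecomposition
      K : Subset N
      K = W ∪ X
      L U : Graph N
      L = G ∪ᴳ H₁ ∪ᴳ H₂ ∪ᴳ H₃
      U = makeClique L K
      P : Fin 3 → Subset N
      P 0F = A
      P 1F = B
      P 2F = C
      H : Fin 3 → Graph N
      H 0F = H₁
      H 1F = H₂
      H 2F = H₃
      ∈V : ∀ {u} → Any (u ∈_) (X ∷ A ∷ B ∷ C ∷ []) → u ∈ V G
      ∈V u∈ = subst (_ ∈_) covers (∈-⋃⁺ u∈)
      X⊆V : X ⊆ V G
      X⊆V u∈X = ∈V (here u∈X)
      P⊆V : ∀ i → P i ∪ X ⊆ V G
      P⊆V 0F = ∪-⊆ (λ u∈ → ∈V (there (here u∈))) X⊆V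
      P⊆V 1F = ∪-⊆ (λ u∈ → ∈V (there (there (here u∈)))) X⊆V
      P⊆V 2F = ∪-⊆ (λ u∈ → ∈V (there (there (there (here u∈))))) X⊆V
      cover : ∀ {u} → u ∈ V G → u ∈ X ⊎ ∃[ i ] u ∈ P i
      cover u∈V with ∈-⋃⁻ (X ∷ A ∷ B ∷ C ∷ []) (subst (_ ∈_) (sym covers) u∈V)
      ... | here u∈X                         = inj₁ u∈X
      ... | there (here u∈A)                 = inj₂ (0F , u∈A)
      ... | there (there (here u∈B))         = inj₂ (1F , u∈B)
      ... | there (there (there (here u∈C))) = inj₂ (2F , u∈C)
      disjoint-X : ∀ i → Disjoint X (P i)
      disjoint-X i with (XA ∷ XB ∷ XC ∷ []) ∷ _ ← disjoint | i
      ... | 0F = XA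
      ... | 1F = XB
      ... | 2F = XC
      disjoint-P : ∀ {i j} → i ≢ j → Disjoint (P i) (P j)
      disjoint-P {i} {j} i≢j with _ ∷ (AB ∷ AC ∷ []) ∷ (BC ∷ []) ∷ _ ← disjoint | i | j
      ... | 0F | 0F = ⊥-elim (i≢j refl)
      ... | 0F | 1F = AB
      ... | 0F | 2F = AC
      ... | 1F | 0F = disjoint-sym AB
      ... | 1F | 1F = ⊥-elim (i≢j refl)
      ... | 1F | 2F = BC
      ... | 2F | 0F = disjoint-sym AC
      ... | 2F | 1F = disjoint-sym BC
      ... | 2F | 2F = ⊥-elim (i≢j refl)
      separated-P : ∀ {i j} → i ≢ j → Separated G (P i) (P j)
      separated-P {i} {j} i≢j with (AB ∷ AC ∷ []) ∷ (BC ∷ []) ∷ _ ← separated | i | j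
      ... | 0F | 0F = ⊥-elim (i≢j refl)
      ... | 0F | 1F = AB
      ... | 0F | 2F = AC
      ... | 1F | 0F = separated-sym {G = G} AB
      ... | 1F | 1F = ⊥-elim (i≢j refl)
      ... | 1F | 2F = BC
      ... | 2F | 0F = separated-sym {G = G} AC
      ... | 2F | 1F = separated-sym {G = G} BC
      ... | 2F | 2F = ⊥-elim (i≢j refl)
      tri : ∀ i → IsTriangulation (G [ P i ∪ X ]) (H i)
      tri 0F = tri₁
      tri 1F = tri₂
      tri 2F = tri₃
      clique : ∀ i → IsClique (H i) (W ∩ P i ∪ X)
      clique 0F = clique₁
      clique 1F = clique₂
      clique 2F = clique₃
      -- Inside a part, `W ∪ X` reduces to the set that the recursive call has already made a
      -- clique.
      K-clique : ∀ i → PairwiseAdjacent (H i) (K ∩ (P i ∪ X))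
      K-clique i u∈ v∈ = proj₂ (clique i) (regroup u∈) (regroup v∈)
        where
        regroup : K ∩ (P i ∪ X) ⊆ W ∩ P i ∪ X
        regroup u∈ with u∈K , u∈PX ← x∈p∩q⁻ K _ u∈ with x∈p∪q⁻ W X u∈K | x∈p∪q⁻ (P i) X u∈PX
        ... | inj₂ u∈X | _        = q⊆p∪q (W ∩ P i) X u∈X
        ... | _        | inj₂ u∈X = q⊆p∪q (W ∩ P i) X u∈X
        ... | inj₁ u∈W | inj₁ u∈P = p⊆p∪q X (x∈p∩q⁺ (u∈W , u∈P))
      VH⊆V : ∀ i → V (H i) ⊆ V G
      VH⊆V i u∈ = proj₁ (x∈p∩q⁻ (V G) _ (subst (_ ∈_) (IsTriangulation.sameVertices (tri i)) u∈))
      V-U : V U ≡ V G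
      V-U = ⊆-antisym (∪-⊆ (∪-⊆ (∪-⊆ id (VH⊆V 0F)) (VH⊆V 1F)) (VH⊆V 2F))
        (p⊆p∪q (V H₃) ∘ p⊆p∪q (V H₂) ∘ p⊆p∪q (V H₁))
      -- `makeClique` ignores labels that are not vertices, so `W ⊆ V G` is carried through the
      -- recursion.
      K⊆VU : K ⊆ V U
      K⊆VU u∈K = subst (_ ∈_) (sym V-U) (∪-⊆ W⊆V X⊆V u∈K)
      K⇒U : PairwiseAdjacent U K
      K⇒U u∈K v∈K u≢v = inj₂ (x∈p∩q⁺ (K⊆VU u∈K , u∈K) , x∈p∩q⁺ (K⊆VU v∈K , v∈K) , u≢v)
      H⇒U : ∀ i {u v} → u ~⟨ H i ⟩ v → u ~⟨ U ⟩ v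
      H⇒U 0F u~v = inj₁ (inj₁ (inj₁ (inj₂ u~v)))
      H⇒U 1F u~v = inj₁ (inj₁ (inj₂ u~v))
      H⇒U 2F u~v = inj₁ (inj₂ u~v)
      U⇒ : ∀ {u v} → u ~⟨ U ⟩ v → u ~⟨ G ⟩ v ⊎ (∃[ i ] u ~⟨ H i ⟩ v) ⊎ (u ∈ K × v ∈ K)
      U⇒ (inj₁ (inj₁ (inj₁ (inj₁ u~v)))) = inj₁ u~v
      U⇒ (inj₁ (inj₁ (inj₁ (inj₂ u~v)))) = inj₂ (inj₁ (0F , u~v))
      U⇒ (inj₁ (inj₁ (inj₂ u~v)))        = inj₂ (inj₁ (1F , u~v))
      U⇒ (inj₁ (inj₂ u~v))               = inj₂ (inj₁ (2F , u~v))
      U⇒ (inj₂ (u∈ , v∈ , _))            =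
        inj₂ (inj₂ (proj₂ (x∈p∩q⁻ (V L) K u∈) , proj₂ (x∈p∩q⁻ (V L) K v∈)))
      open Glue G X K P H U (q⊆p∪q W X) P⊆V cover disjoint-X disjoint-P separated-P tri K-clique
        V-U (inj₁ ∘ inj₁ ∘ inj₁ ∘ inj₁) H⇒U K⇒U U⇒ using (glue-triangulation; glue-clique)
      light : ∀ {Q} → Q ⊆ K ⊎ ∃[ i ] IsClique (H i) Q → weight Q < T
      light (inj₁ Q⊆K)             = ≤-<-trans (≤-trans (weight-mono Q⊆K) (weight-∪ W X)) (light-∪ W-light X-light)
      light (inj₂ (0F , Q-clique)) = light₁ Q-clique
      light (inj₂ (1F , Q-clique)) = light₂ Q-clique
      light (inj₂ (2F , Q-clique)) = light₃ Q-clique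

    part⊆V : ∀ {G : Graph N} {W X A B C S} → W ⊆ V G → IsDecomposition G X A B C → W ∩ S ∪ X ⊆ V (G [ S ∪ X ])
    part⊆V {W = W} {X = X} {S = S} W⊆V d = ∪-⊆
      (λ u∈ → let u∈W , u∈S = x∈p∩q⁻ W S u∈ in x∈p∩q⁺ (W⊆V u∈W , p⊆p∪q X u∈S))
      (λ u∈X → x∈p∩q⁺ (subst (_ ∈_) (IsDecomposition.covers d) (x∈p∪q⁺ (inj₁ u∈X)) , q⊆p∪q S X u∈X))

    wTriangulateAcc-correct : ∀ G W (a : Acc ℕ._<_ ∣ V G ∣) → W ⊆ V G → weight W < M →
                              IsCorrect G W (wTriangulateAcc m α choices G W a)
    wTriangulateAcc-correct G W (acc rs) W⊆V W<M with weight (V G) <? T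
    ... | yes V<T = inj₁ (H , refl , record
        { sameVertices = sameVertices ; addsEdges = addsEdges ∘ inj₁ ; chordal = chordal }
      , ((λ u∈W → subst (_ ∈_) (sym sameVertices) (W⊆V u∈W))
        , λ u∈W v∈W u≢v → addsEdges (inj₂ (x∈p∩q⁺ (W⊆V u∈W , u∈W) , x∈p∩q⁺ (W⊆V v∈W , v∈W) , u≢v)))
      -- In the base case all of `V G` together weighs less than `T`.
      , λ Q-clique → ≤-<-trans (weight-mono λ u∈Q → subst (_ ∈_) sameVertices (proj₁ Q-clique u∈Q)) V<T)
      where
      H : Graph N
      H = minWeightFill m α choices (makeClique G W)
      open IsTriangulation (fillAcc-triangulation (makeClique G W) (<-wellFounded _))
    ... | no V≮T with Choices.findDecomposition choices G W
    ...   | no ∄d = inj₂ (refl , ∄d ∘ narrow⇒wDecomposition T≤V W<M)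
      where
      T≤V : T ≤ weight (V G)
      T≤V with T ≤? weight (V G)
      ... | yes T≤V = T≤V
      ... | no  T≰V = ⊥-elim (V≮T (≰⇒> T≰V))
    ...   | yes (X , A , B , C , d) = combine-correct W⊆V d
      (wTriangulateAcc-correct _ _ (rs _) (part⊆V W⊆V isDecomposition) A-light)
      (wTriangulateAcc-correct _ _ (rs _) (part⊆V W⊆V isDecomposition) B-light)
      (wTriangulateAcc-correct _ _ (rs _) (part⊆V W⊆V isDecomposition) C-light)
      where open IsWDecomposition d

theorem4 :
  (R : CompleteOrderedField) → let open CompleteOrderedField R in
  ∀ {N} (G : Graph N) →
  (D : Fin N → Set) (∣D∣ : Fin N → ℕ) →
  (∀ v → D v ↔ Fin (∣D∣ v)) →
  (2≤∣D∣ : ∀ v → 2 ℕ.≤ ∣D∣ v) →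
  let w = λ v → log₂ (∣D∣ v) {{ℕ.>-nonZero (<⇒≤ (2≤∣D∣ v))}}
      open Weighted R w
  in
  (m α : ℝ) → 1# ≤ α →
  (W : Subset N) → W ⊆ V G → weight W < (α + 1#) * m →
  (choices : Choices m α) →
    (∃[ H ] (wTriangulate m α choices G W ≡ triangulated H
      × IsTriangulation G H
      × IsClique H W
      × ∃[ c ] (IsHeaviestCliqueWeight H c × c < (2# * α + 1#) * m)))
  ⊎ (wTriangulate m α choices G W ≡ cliquewidth>m
      × ∃[ c ] (IsWeightedCliquewidth G c × m < c))
theorem4 R {N} G D ∣D∣ D↔Fin 2≤∣D∣ m α 1≤α W W⊆V W-light choices =
  Sum.map heaviest-light cliquewidth>m-correct
    (wTriangulateAcc-correct choices G W (<-wellFounded _) W⊆V W-light)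
  where
  open CompleteOrderedField R
  instance
    ∣D∣-nonZero : ∀ {v} → ℕ.NonZero (∣D∣ v)
    ∣D∣-nonZero {v} = ℕ.>-nonZero (<⇒≤ (2≤∣D∣ v))
  w : Fin N → ℝ
  w v = log₂ (∣D∣ v)
  0≤w : ∀ v → 0# ≤ w v
  -- The logarithm is a supremum of a set that contains 0.
  0≤w v = proj₁ (proj₂ (complete _ _ _)) (0-belowLog₂ (∣D∣ v))
  open Weighted R w
  open NonnegativeWeights R w 0≤w
  open Correctness R w 0≤w m α 1≤α
  heaviest-light : ∀ {o} →
    ∃[ H ] (o ≡ triangulated H × IsTriangulation G H × IsClique H W
      × (∀ {Q} → IsClique H Q → weight Q < T)) →
    ∃[ H ] (o ≡ triangulated H × IsTriangulation G H × IsClique H W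
      × ∃[ c ] (IsHeaviestCliqueWeight H c × c < T))
  heaviest-light (H , o≡ , tri , W-clique , light) =
    let c , heaviest@((_ , Q-clique , Q≈c) , _) = heaviestClique H
    in H , o≡ , tri , W-clique , c , heaviest , ≤-<-trans (≤-reflexive (≈-sym Q≈c)) (light Q-clique)
  cliquewidth>m-correct : ∀ {o} →
    o ≡ cliquewidth>m × ¬ Narrow G →
    o ≡ cliquewidth>m × ∃[ c ] (IsWeightedCliquewidth G c × m < c)
  cliquewidth>m-correct (o≡ , wide) =
    -- If the minimum were at most m, the triangulation attaining it would make `G` narrow.
    o≡ , c , optimum⇒cliquewidth o , ≰⇒> λ c≤m →
      wide (H , triangulation , λ Q-clique → ≤-trans (heaviest-bound H heaviest Q-clique) c≤m)
    where
    o : Optimum G Unrestricted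
    o = optimum G (<-wellFounded _)
    open Optimum o
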